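{- Let $D$ be a strongly connected balanced bipartite digraph of order $2a$, where $a\geq 2$. Suppose that for every dominating pair $\{u,v\}$ of vertices in $D$, \[ d(u)+d(v)\geq 3a+1. \] Then $D$ is hamiltonian.
   Context: Digraphs have no loops and no multiple arcs. For a vertex $v$, $d(v)=d^+(v)+d^-(v)$ is the sum of its out-degree and in-degree. A pair of distinct vertices $\{u,v\}$ is dominating if there is a vertex $w$ with $uw$ and $vw$ both arcs of $D$. A balanced bipartite digraph has two partite sets of equal size. Hamiltonian means containing a directed cycle through all vertices. -}

module Defs where

open import Data.Nat using (ℕ; zero; suc; _+_; _≤_; _≥_)
open import Data.Bool using (Bool; true; false; if_then_else_)
open import Data.Fin using (Fin; zero; suc)
open import Data.List using (List; []; _∷_; filter; length; allFin)
open import Data.Product using (Σ; ∃; _×_; _,_)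
open import Relation.Binary.PropositionalEquality using (_≡_; _≢_)
open import Relation.Nullary using (¬_)
open import Data.Empty using (⊥)
open import Function.Definitions using (Injective)

record Digraph (n : ℕ) : Set where
  field
    arc      : Fin n → Fin n → Bool
    loopless : ∀ v → arc v v ≡ false
open Digraph public

Arc : ∀ {n} → Digraph n → Fin n → Fin n → Set
Arc D u v = arc D u v ≡ true

count : ∀ {n} → (Fin n → Bool) → ℕ
count {n} p = length (filter (λ i → Data.Bool._≟_ (p i) true) (allFin n))

outdeg indeg deg : ∀ {n} → Digraph n → Fin n → ℕ
outdeg D v = count (λ w → arc D v w)
indeg  D v = count (λ w → arc D w v)
deg    D v = outdeg D v + indeg D v

data Walk {n} (D : Digraph n) : Fin n → Fin n → Set where
  here : ∀ {v} → Walk D v v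
  step : ∀ {u w v} → Arc D u w → Walk D w v → Walk D u v

StronglyConnected : ∀ {n} → Digraph n → Set
StronglyConnected D = ∀ u v → Walk D u v

BalancedBipartition : ∀ {n} → Digraph n → ℕ → (Fin n → Bool) → Set
BalancedBipartition D a c =
  count c ≡ a × count (λ v → if c v then false else true) ≡ a ×
  (∀ u v → Arc D u v → c u ≢ c v)

BalancedBipartite : ∀ {n} → Digraph n → ℕ → Set
BalancedBipartite D a = Σ _ (BalancedBipartition D a)

Dominating : ∀ {n} → Digraph n → Fin n → Fin n → Set
Dominating D u v = u ≢ v × ∃ λ w → Arc D u w × Arc D v w

next : ∀ {m} → Fin (suc m) → Fin (suc m)
next {m} i = Data.Fin.fromℕ< (Data.Nat.DivMod.m%n<n (suc (Data.Fin.toℕ i)) (suc m))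
  where import Data.Nat.DivMod

-- Hamiltonian: a cyclic ordering of all vertices (an injective, hence
-- bijective, enumeration σ) with σ i → σ (i+1 mod n) an arc for all i.
Hamiltonian : ∀ {n} → Digraph n → Set
Hamiltonian {zero}  D = ⊥ -- irrelevant here: the order is 2a ≥ 4
Hamiltonian {suc m} D =
  Σ (Fin (suc m) → Fin (suc m)) λ σ → Injective _≡_ _≡_ σ × (∀ i → Arc D (σ i) (σ (next i)))

{-# OPTIONS --safe #-}

-- If v → w and v belongs to no dominating pair, neither does w; hence either no pair dominates at all and D is a
-- single cycle, or every vertex has a partner and therefore degree at least a + 1. In the latter case a Hall violator
-- S would have more than a/2 vertices, and two vertices missed by the out-neighbourhood of S would each have
-- out-degree above a/2, hence dominate together with too small a degree sum; so D has a cycle factor v ↦ π v.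
--
-- Let C be a union of cycles of π with r ≤ a/2 vertices on each side. If u → π v and v → π u for some u in C and v
-- outside, swapping the successors of u and v merges their cycles. Otherwise the vertices of C have in total at most
-- 2r(a − r) arcs to and from the complement. Call v small if 2 d(v) ≤ 3a: small vertices pairwise do not dominate,
-- which bounds the number of arcs inside C and, for r ≥ 2, makes the degree sum over C too large. For r = 1 every
-- estimate is tight, so all vertices outside C have degree 2a and a merge is possible after all.

module Submission where

open import Defs
open import Data.Nat using (ℕ; zero; suc; _+_; _*_; _∸_; _≤_; _≥_; _<_; z≤n; s≤s; _≤?_; _<?_)
open import Data.Nat.Properties hiding (_≟_)
open import Data.Nat.DivMod using (_%_; m%n<n; m<n⇒m%n≡m; n%n≡0)
open import Data.Nat.Tactic.RingSolver using (solve-∀)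
open import Data.Bool using (Bool; true; false; not; _∧_; _∨_; if_then_else_)
import Data.Bool as Bool
open import Data.Bool.Properties using (¬-not; not-¬; not-involutive)
open import Data.Fin using (Fin; zero; suc; toℕ; fromℕ<)
open import Data.Fin.Properties
  using (_≟_; any?; pigeonhole; toℕ<n; toℕ-fromℕ<; toℕ-injective; fromℕ<-injective; injective⇒≤)
open import Data.List using (filter; length; tabulate)
open import Data.Product using (∃; ∃₂; _×_; _,_; proj₁; proj₂)
open import Data.Sum using (_⊎_; inj₁; inj₂)
open import Data.Empty using (⊥; ⊥-elim)
open import Function using (_∘_; id)
open import Function.Definitions using (Injective)
open import Relation.Binary using (tri<; tri≈; tri>)
open import Relation.Nullary using (¬_; Dec; yes; no; does; _×-dec_)
open import Relation.Nullary.Decidable using (dec-true; dec-false; ¬?)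
open import Relation.Binary.PropositionalEquality
  using (_≡_; _≢_; refl; sym; trans; cong; cong₂; subst; module ≡-Reasoning)
open import Algebra.Properties.Semiring.Sum +-*-semiring
  using (sum; sum-cong-≗; ∑-distrib-+; ∑-comm; *-distribˡ-sum; *-distribʳ-sum; sum-replicate-zero)

-- Counting on finite sets

private variable
  n m : ℕ

ι : Bool → ℕ
ι b = if b then 1 else 0

# : (Fin n → Bool) → ℕ
# p = sum (ι ∘ p)

δ : Fin n → Fin n → Bool
δ x v = does (x ≟ v)

does⇒ : ∀ {P : Set} (P? : Dec P) → does P? ≡ true → P
does⇒ (yes p) _ = p

does⇒¬ : ∀ {P : Set} (P? : Dec P) → does P? ≡ false → ¬ P
does⇒¬ (no ¬p) _ = ¬p

not-both : ∀ {b} → b ≡ true → b ≡ false → ⊥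
not-both refl ()

∧-true : ∀ {x y} → x ∧ y ≡ true → x ≡ true × y ≡ true
∧-true {true} {true} refl = refl , refl

true-∧ : ∀ {x y} → x ≡ true → y ≡ true → x ∧ y ≡ true
true-∧ refl refl = refl

not-true : ∀ {x} → not x ≡ true → x ≡ false
not-true {false} _ = refl

ι*-≤ : ∀ b {k m} → (b ≡ true → k ≤ m) → ι b * k ≤ m
ι*-≤ true  {k} h rewrite +-identityʳ k = h refl
ι*-≤ false h = z≤n

ι*-mono : ∀ b {k m} → (b ≡ true → k ≤ m) → ι b * k ≤ ι b * m
ι*-mono true  h = *-monoʳ-≤ 1 (h refl)
ι*-mono false h = z≤n

ι-≤ : ∀ b {m} → (b ≡ true → 1 ≤ m) → ι b ≤ m
ι-≤ true  h = h refl
ι-≤ false h = z≤n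

ι≤1 : ∀ b → ι b ≤ 1
ι≤1 b = ι-≤ b λ _ → ≤-refl

ι-true : ∀ {b} → b ≡ true → 1 ≤ ι b
ι-true refl = ≤-refl

sum-mono : {f g : Fin n → ℕ} → (∀ i → f i ≤ g i) → sum f ≤ sum g
sum-mono {zero}  h = z≤n
sum-mono {suc n} h = +-mono-≤ (h zero) (sum-mono (h ∘ suc))

sum-mono-+ : {f f′ g : Fin n → ℕ} → (∀ i → f i + f′ i ≤ g i) → sum f + sum f′ ≤ sum g
sum-mono-+ {f = f} {f′} h = ≤-trans (≤-reflexive (sym (∑-distrib-+ f f′))) (sum-mono h)

sum-0 : {f : Fin n → ℕ} → (∀ i → f i ≡ 0) → sum f ≡ 0
sum-0 {n} h = trans (sum-cong-≗ h) (sum-replicate-zero n)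

-- This lets a correction at a single vertex enter a pointwise comparison of two sums.
sum-δ : (x : Fin n) (f : Fin n → ℕ) → sum (λ v → ι (δ x v) * f v) ≡ f x
sum-δ zero    f = trans (cong₂ _+_ (+-identityʳ (f zero)) (sum-0 {f = λ i → ι (δ zero (suc i)) * f (suc i)} λ i → refl)) (+-identityʳ (f zero))
sum-δ (suc x) f = sum-δ x (f ∘ suc)

#δ : (x : Fin n) → # (δ x) ≡ 1
#δ x = trans (sum-cong-≗ λ v → sym (*-identityʳ (ι (δ x v)))) (sum-δ x λ _ → 1)

#-mono : {p q : Fin n → Bool} → (∀ v → p v ≡ true → q v ≡ true) → # p ≤ # q
#-mono {p = p} h = sum-mono λ v → ι-≤ (p v) λ e → ι-true (h v e)

sum-weight : (p : Fin n → Bool) (k : ℕ) → sum (λ v → ι (p v) * k) ≡ # p * k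
sum-weight p k = sym (*-distribʳ-sum k (ι ∘ p))

#-empty : {p : Fin n → Bool} → (∀ v → p v ≢ true) → # p ≡ 0
#-empty {p = p} none = sum-0 λ v → n≤0⇒n≡0 (ι-≤ (p v) λ e → ⊥-elim (none v e))

#-unique : {p : Fin n → Bool} → (∀ u v → p u ≡ true → p v ≡ true → u ≡ v) → # p ≤ 1
#-unique {p = p} h with any? (λ v → p v Bool.≟ true)
... | yes (x , px) = ≤-trans (#-mono {q = δ x} λ v pv → dec-true (x ≟ v) (h x v px pv)) (≤-reflexive (#δ x))
... | no none = ≤-trans (≤-reflexive (#-empty λ v e → none (v , e))) z≤n

#≥1⇒∃ : {p : Fin n → Bool} → 1 ≤ # p → ∃ λ v → p v ≡ true
#≥1⇒∃ {p = p} h with any? (λ v → p v Bool.≟ true)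
... | yes r = r
... | no none = ⊥-elim (1+n≰n (≤-trans h (≤-reflexive (#-empty λ v e → none (v , e)))))

∃⇒#≥1 : {p : Fin n → Bool} (v : Fin n) → p v ≡ true → 1 ≤ # p
∃⇒#≥1 {p = p} x px = ≤-trans (≤-reflexive (sym (#δ x)))
  (#-mono λ v e → subst (λ w → p w ≡ true) (does⇒ (x ≟ v) e) px)

#-insert : {p q : Fin n → Bool} (x : Fin n) → (∀ v → p v ≡ true → q v ≡ true) →
  p x ≡ false → q x ≡ true → # p + 1 ≤ # q
#-insert {p = p} {q} x h px qx =
  ≤-trans (+-monoʳ-≤ (# p) (≤-reflexive (sym (#δ x)))) (sum-mono-+ pointwise)
  where
  pointwise : ∀ v → ι (p v) + ι (δ x v) ≤ ι (q v)
  pointwise v with p v in pv | x ≟ v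
  ... | true  | yes refl = ⊥-elim (not-both pv px)
  ... | true  | no _     = ι-true (h v pv)
  ... | false | yes refl = ι-true qx
  ... | false | no _     = z≤n

#≥2⇒∃≢ : {p : Fin n → Bool} (x : Fin n) → 2 ≤ # p → ∃ λ v → x ≢ v × p v ≡ true
#≥2⇒∃≢ {p = p} x h with any? (λ v → ¬? (x ≟ v) ×-dec (p v Bool.≟ true))
... | yes r = r
... | no none = ⊥-elim (1+n≰n (≤-trans h (#-unique λ u v pu pv → trans (sym (only u pu)) (only v pv))))
  where
  only : ∀ v → p v ≡ true → x ≡ v
  only v pv with x ≟ v
  ... | yes e = e
  ... | no ne = ⊥-elim (none (v , ne , pv))

#≤n : (p : Fin n → Bool) → # p ≤ n
#≤n {zero}  p = z≤n
#≤n {suc n} p = +-mono-≤ (ι≤1 (p zero)) (#≤n (p ∘ suc))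

∃≢⇒#≥2 : {p : Fin n → Bool} {u v : Fin n} → u ≢ v → p u ≡ true → p v ≡ true → 2 ≤ # p
∃≢⇒#≥2 {p = p} {u} {v} u≢v pu pv = ≤-trans (+-monoˡ-≤ 1 (≤-reflexive (sym (#δ u))))
  (#-insert v (λ w e → subst (λ w → p w ≡ true) (does⇒ (u ≟ w) e) pu) (dec-false (u ≟ v) u≢v) pv)

-- Each `v` in `p` lies in exactly one fibre of `h`. Bounding every fibre above or below by one then
-- compares the sizes of domain and codomain.
#-fibres : (p : Fin n → Bool) (h : Fin n → Fin m) → # p ≡ sum (λ w → # λ v → p v ∧ δ (h v) w)
#-fibres p h = begin-equality
  # p                                                ≡⟨ sum-cong-≗ (λ v → trans (sym (*-identityʳ (ι (p v))))
                                                        (trans (cong (ι (p v) *_) (sym (#δ (h v)))) (*-distribˡ-sum (ι (p v)) (ι ∘ δ (h v))))) ⟩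
  sum (λ v → sum λ w → ι (p v) * ι (δ (h v) w))      ≡⟨ ∑-comm (λ v w → ι (p v) * ι (δ (h v) w)) ⟩
  sum (λ w → sum λ v → ι (p v) * ι (δ (h v) w))      ≡⟨ sum-cong-≗ (λ w → sum-cong-≗ λ v → ι-∧ (p v) (δ (h v) w)) ⟩
  sum (λ w → # λ v → p v ∧ δ (h v) w)                ∎
  where
  open ≤-Reasoning
  ι-∧ : ∀ x y → ι x * ι y ≡ ι (x ∧ y)
  ι-∧ true  y = +-identityʳ (ι y)
  ι-∧ false y = refl

#-injection : {p : Fin n → Bool} {q : Fin m → Bool} (h : Fin n → Fin m) →
  (∀ v → p v ≡ true → q (h v) ≡ true) →
  (∀ u v → p u ≡ true → p v ≡ true → h u ≡ h v → u ≡ v) → # p ≤ # q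
#-injection {p = p} {q} h into inj = ≤-trans (≤-reflexive (#-fibres p h)) (sum-mono fibre)
  where
  fibre : ∀ w → # (λ v → p v ∧ δ (h v) w) ≤ ι (q w)
  fibre w with q w in qw
  ... | true  = #-unique λ u v eu ev →
        let pu , hu = ∧-true eu ; pv , hv = ∧-true ev
        in inj u v pu pv (trans (does⇒ (h u ≟ w) hu) (sym (does⇒ (h v ≟ w) hv)))
  ... | false = ≤-reflexive (#-empty λ v e →
        let pv , hv = ∧-true e
        in not-both (into v pv) (trans (cong q (does⇒ (h v ≟ w) hv)) qw))

#-surjection : {p : Fin n → Bool} {q : Fin m → Bool} (h : Fin n → Fin m) →
  (∀ w → q w ≡ true → ∃ λ v → p v ≡ true × h v ≡ w) → # q ≤ # p
#-surjection {p = p} {q} h onto = ≤-trans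
  (sum-mono λ w → ι-≤ (q w) λ qw → let v , pv , e = onto w qw in ∃⇒#≥1 v (true-∧ pv (dec-true (h v ≟ w) e)))
  (≤-reflexive (sym (#-fibres p h)))

#-pigeonhole : {p : Fin n → Bool} {q : Fin m → Bool} (h : Fin n → Fin m) →
  (∀ v → p v ≡ true → q (h v) ≡ true) → # q < # p →
  ∃₂ λ u v → u ≢ v × p u ≡ true × p v ≡ true × h u ≡ h v
#-pigeonhole {p = p} h into lt
  with any? (λ u → any? λ v → ¬? (u ≟ v) ×-dec (p u Bool.≟ true) ×-dec (p v Bool.≟ true) ×-dec (h u ≟ h v))
... | yes (u , v , r) = u , v , r
... | no none = ⊥-elim (<⇒≱ lt (#-injection h into inj))
  where
  inj : ∀ u v → p u ≡ true → p v ≡ true → h u ≡ h v → u ≡ v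
  inj u v pu pv e with u ≟ v
  ... | yes r = r
  ... | no ne = ⊥-elim (none (u , v , ne , pu , pv , e))

#-split : (p q : Fin n → Bool) → # p ≡ # (λ v → q v ∧ p v) + # (λ v → not (q v) ∧ p v)
#-split p q = trans (sum-cong-≗ λ v → pointwise (p v) (q v)) (∑-distrib-+ (λ v → ι (q v ∧ p v)) _)
  where
  pointwise : ∀ x y → ι x ≡ ι (y ∧ x) + ι (not y ∧ x)
  pointwise x true  = sym (+-identityʳ (ι x))
  pointwise x false = refl

#-overlap : {p q s : Fin n → Bool} → (∀ v → p v ≡ true → s v ≡ true) → (∀ v → q v ≡ true → s v ≡ true) →
  # s < # p + # q → ∃ λ v → p v ≡ true × q v ≡ true
#-overlap {p = p} {q} {s} ps qs lt with any? (λ v → (p v Bool.≟ true) ×-dec (q v Bool.≟ true))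
... | yes r = r
... | no none = ⊥-elim (<⇒≱ lt (sum-mono-+ pointwise))
  where
  pointwise : ∀ v → ι (p v) + ι (q v) ≤ ι (s v)
  pointwise v with p v in pv | q v in qv
  ... | true  | true  = ⊥-elim (none (v , pv , qv))
  ... | true  | false = ι-true (ps v pv)
  ... | false | true  = ι-true (qs v qv)
  ... | false | false = z≤n

-- If `w` were missed, `π` would inject all `n` vertices into the `n - 1` vertices other than `w`.
injective⇒surjective : {π : Fin n → Fin n} → Injective _≡_ _≡_ π → ∀ w → ∃ λ v → π v ≡ w
injective⇒surjective {π = π} inj w with any? (λ v → π v ≟ w)
... | yes r = r
... | no miss = ⊥-elim (1+n≰n (≤-trans (≤-reflexive (+-comm 1 _))
        (≤-trans (#-insert {p = λ v → not (δ w v)} {q = λ _ → true} w (λ _ _ → refl)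
                    (cong not (dec-true (w ≟ w) refl)) refl)
          (#-injection π (λ v _ → cong not (dec-false (w ≟ π v) λ e → miss (v , sym e))) λ u v _ _ → inj))))

-- Every `w` has a preimage, so its value is counted at least once when the double sum is grouped by
-- `w`; grouped by `v` it is the sum of `f ∘ π`.
sum-reindex : {π : Fin n → Fin n} → Injective _≡_ _≡_ π → (f : Fin n → ℕ) → sum f ≤ sum (f ∘ π)
sum-reindex {π = π} inj f = begin
  sum f                                       ≤⟨ sum-mono (λ w → ≤-trans (≤-reflexive (sym (+-identityʳ (f w)))) (*-monoˡ-≤ (f w) (hit w))) ⟩
  sum (λ w → # (λ v → δ (π v) w) * f w)       ≡⟨ sum-cong-≗ (λ w → sym (sum-weight (λ v → δ (π v) w) (f w))) ⟩
  sum (λ w → sum λ v → ι (δ (π v) w) * f w)   ≡⟨ ∑-comm (λ w v → ι (δ (π v) w) * f w) ⟩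
  sum (λ v → sum λ w → ι (δ (π v) w) * f w)   ≡⟨ sum-cong-≗ (λ v → sum-δ (π v) f) ⟩
  sum (f ∘ π)                                 ∎
  where
  open ≤-Reasoning
  hit : ∀ w → 1 ≤ # (λ v → δ (π v) w)
  hit w with v , e ← injective⇒surjective inj w = ∃⇒#≥1 v (dec-true (π v ≟ w) e)

term≤sum : (f : Fin n → ℕ) (x : Fin n) → f x ≤ sum f
term≤sum f x = ≤-trans (≤-reflexive (sym (sum-δ x f))) (sum-mono λ v → ι*-≤ (δ x v) λ _ → ≤-refl)

≡-by-true : ∀ {x y} → (x ≡ true → y ≡ true) → (y ≡ true → x ≡ true) → x ≡ y
≡-by-true {true}  {y}     f g = sym (f refl)
≡-by-true {false} {true}  f g = g refl
≡-by-true {false} {false} f g = refl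

count≡# : (p : Fin n → Bool) → count p ≡ # p
count≡# {n} p = go n id
  where
  go : ∀ k (f : Fin k → Fin n) → length (filter (λ i → p i Bool.≟ true) (tabulate f)) ≡ # (p ∘ f)
  go zero    f = refl
  go (suc k) f with p (f zero)
  ... | true  = cong suc (go k (f ∘ suc))
  ... | false = go k (f ∘ suc)

-- Cycle factors and their orbits

record CycleFactor {n} (D : Digraph n) : Set where
  field
    π     : Fin n → Fin n
    π-inj : Injective _≡_ _≡_ π
    π-arc : ∀ v → Arc D v (π v)

-- Hall's theorem, by augmenting paths, for the bipartite graph joining tails to heads.
module Hall {n} (D : Digraph n) where

  private
    V : Set
    V = Fin n

  -- A Hall violator without cardinalities: `f` maps `S` minus `root` onto all out-neighbours of
  -- `S`. The arc from `t` to `y` is recorded so that the violator can later be cut down to one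
  -- partite set.
  record Deficient : Set where
    field
      S       : V → Bool
      root    : V
      f       : V → V
      root∈S  : S root ≡ true
      covered : ∀ {s y} → S s ≡ true → Arc D s y → ∃ λ t → t ≢ root × f t ≡ y × Arc D t y × S t ≡ true

  record Matching (P : V → Set) : Set where
    field
      f     : V → V
      f-arc : ∀ {v} → P v → Arc D v (f v)
      f-inj : ∀ {u v} → P u → P v → f u ≡ f v → u ≡ v

  assign : (V → V) → V → V → V → V
  assign g s y v with s ≟ v
  ... | yes _ = y
  ... | no  _ = g v

  assign-≢ : ∀ {g s y v} → v ≢ s → assign g s y v ≡ g v
  assign-≢ {s = s} {v = v} ne with s ≟ v
  ... | yes e = ⊥-elim (ne (sym e))
  ... | no _  = refl

  assign-matching : ∀ {P : V → Set} {g s y} → Arc D s y →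
    (∀ {v} → P v → v ≢ s → Arc D v (g v)) →
    (∀ {u v} → P u → u ≢ s → P v → v ≢ s → g u ≡ g v → u ≡ v) →
    (∀ {v} → P v → v ≢ s → g v ≢ y) → Matching P
  assign-matching {P} {g} {s} {y} sy g-arc g-inj fresh = record { f = assign g s y ; f-arc = f-arc ; f-inj = f-inj }
    where
    f-arc : ∀ {v} → P v → Arc D v (assign g s y v)
    f-arc {v} Pv with s ≟ v
    ... | yes refl = sy
    ... | no ne    = g-arc Pv (ne ∘ sym)
    f-inj : ∀ {u v} → P u → P v → assign g s y u ≡ assign g s y v → u ≡ v
    f-inj {u} {v} Pu Pv e with s ≟ u | s ≟ v
    ... | yes refl | yes refl = refl
    ... | yes refl | no ne    = ⊥-elim (fresh Pv (ne ∘ sym) (sym e))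
    ... | no ne    | yes refl = ⊥-elim (fresh Pu (ne ∘ sym) e)
    ... | no ne    | no ne′   = g-inj Pu (ne ∘ sym) Pv (ne′ ∘ sym) e

  module Augment (Dom : V → Bool) (M : Matching (λ v → Dom v ≡ true)) (root : V) (root∉Dom : Dom root ≡ false) where

    open Matching M

    Dom⁺ : V → Set
    Dom⁺ v = Dom v ≡ true ⊎ v ≡ root

    -- The result of shifting the matching along an alternating path from root to s inside S:
    -- root becomes matched and s becomes free.
    record Shift (S : V → Bool) (s : V) : Set where
      field
        g     : V → V
        g-arc : ∀ {v} → Dom⁺ v → v ≢ s → Arc D v (g v)
        g-inj : ∀ {u v} → Dom⁺ u → u ≢ s → Dom⁺ v → v ≢ s → g u ≡ g v → u ≡ v
        agree : ∀ {v} → S v ≡ false → Dom v ≡ true → g v ≡ f v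
        image : ∀ {v} → Dom⁺ v → v ≢ s → ∃ λ d → Dom d ≡ true × f d ≡ g v

    -- `S` holds tails reached from `root` by alternating paths. In place of the paths, each tail
    -- carries the matching obtained by shifting along its path.
    record Tree : Set where
      field
        S       : V → Bool
        root∈S  : S root ≡ true
        S⊆Dom⁺  : ∀ {s} → S s ≡ true → Dom⁺ s
        shift   : ∀ {s} → S s ≡ true → Shift S s

    initial : Tree
    initial = record
      { S = δ root
      ; root∈S = dec-true (root ≟ root) refl
      ; S⊆Dom⁺ = λ {s} e → inj₂ (sym (does⇒ (root ≟ s) e))
      ; shift = λ {s} e → subst (Shift (δ root)) (does⇒ (root ≟ s) e) record
          { g = f
          ; g-arc = λ v∈ ne → f-arc (in-Dom v∈ ne)
          ; g-inj = λ u∈ neu v∈ nev → f-inj (in-Dom u∈ neu) (in-Dom v∈ nev)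
          ; agree = λ _ _ → refl
          ; image = λ {v} v∈ ne → v , in-Dom v∈ ne , refl
          } }
      where
      in-Dom : ∀ {v} → Dom⁺ v → v ≢ root → Dom v ≡ true
      in-Dom (inj₁ v∈) _  = v∈
      in-Dom (inj₂ e)  ne = ⊥-elim (ne e)

    -- The head `y` is used by `d` outside the tree. Shifting to `s` frees `s`; handing `y` to `s`
    -- then frees `d` instead, so `d` joins the tree.
    module Grow (T : Tree) {s y d : V} (s∈S : Tree.S T s ≡ true) (sy : Arc D s y)
      (d∈Dom : Dom d ≡ true) (fd≡y : f d ≡ y) (d∉S : Tree.S T d ≡ false) where

      open Tree T

      S′ : V → Bool
      S′ v = δ d v ∨ S v

      S′-split : ∀ {v} → S′ v ≡ true → d ≡ v ⊎ S v ≡ true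
      S′-split {v} e with d ≟ v
      ... | yes p = inj₁ p
      ... | no _  = inj₂ e

      S⊆S′ : ∀ {v} → S v ≡ true → S′ v ≡ true
      S⊆S′ {v} e with d ≟ v
      ... | yes _ = refl
      ... | no _  = e

      ∉S′⇒∉S : ∀ {v} → S′ v ≡ false → S v ≡ false
      ∉S′⇒∉S {v} e with d ≟ v
      ... | no _  = e

      d≢s : d ≢ s
      d≢s refl = not-both s∈S d∉S

      shift-d : Shift S′ d
      shift-d = record
        { g = assign g s y
        ; g-arc = λ v∈ ne → Matching.f-arc assigned (v∈ , ne)
        ; g-inj = λ u∈ neu v∈ nev → Matching.f-inj assigned (u∈ , neu) (v∈ , nev)
        ; agree = λ {v} v∉ v∈ → trans (assign-≢ {g} {s} {y} λ { refl → not-both s∈S (∉S′⇒∉S v∉) }) (agree (∉S′⇒∉S v∉) v∈)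
        ; image = img }
        where
        open Shift (shift s∈S)
        assigned : Matching (λ v → Dom⁺ v × v ≢ d)
        assigned = assign-matching sy (λ (v∈ , _) → g-arc v∈) (λ (u∈ , _) nu (v∈ , _) → g-inj u∈ nu v∈)
          -- The shifted matching still sends `d` to `y`, because it agrees with `f` outside `S`. By
          -- injectivity no other vertex uses `y`.
          λ (v∈ , v≢d) v≢s e → v≢d (g-inj v∈ v≢s (inj₁ d∈Dom) d≢s (trans e (trans (sym fd≡y) (sym (agree d∉S d∈Dom)))))
        img : ∀ {v} → Dom⁺ v → v ≢ d → ∃ λ d → Dom d ≡ true × f d ≡ assign g s y v
        img {v} v∈ _ with s ≟ v
        ... | yes _ = d , d∈Dom , fd≡y
        ... | no ne = image v∈ (ne ∘ sym)

      grown : Tree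
      grown = record
        { S = S′
        ; root∈S = S⊆S′ root∈S
        ; S⊆Dom⁺ = λ e → case-⊆ (S′-split e)
        ; shift = λ e → case-shift (S′-split e) }
        where
        case-⊆ : ∀ {v} → d ≡ v ⊎ S v ≡ true → Dom⁺ v
        case-⊆ (inj₁ refl) = inj₁ d∈Dom
        case-⊆ (inj₂ v∈)   = S⊆Dom⁺ v∈
        case-shift : ∀ {v} → d ≡ v ⊎ S v ≡ true → Shift S′ v
        case-shift (inj₁ refl) = shift-d
        case-shift (inj₂ v∈)   = record
          { g = g ; g-arc = g-arc ; g-inj = g-inj ; agree = λ e → agree (∉S′⇒∉S e) ; image = image }
          where open Shift (shift v∈)

      larger : # S + 1 ≤ # S′
      larger = #-insert {p = S} {q = S′} d (λ v → S⊆S′) d∉S (cong (_∨ S d) (dec-true (d ≟ d) refl))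

    search : ∀ k (T : Tree) → n ≤ k + # (Tree.S T) → Matching Dom⁺ ⊎ Deficient
    search k T bound
      with any? (λ s → any? λ y → (S s Bool.≟ true) ×-dec (arc D s y Bool.≟ true) ×-dec
                   ¬? (any? λ t → ¬? (t ≟ root) ×-dec (f t ≟ y) ×-dec (S t Bool.≟ true)))
      where open Tree T
    ... | no none = inj₂ record { S = S ; root = root ; f = f ; root∈S = root∈S ; covered = covered }
      where
      open Tree T
      covered : ∀ {s y} → S s ≡ true → Arc D s y → ∃ λ t → t ≢ root × f t ≡ y × Arc D t y × S t ≡ true
      covered {s} {y} s∈ sy with any? (λ t → ¬? (t ≟ root) ×-dec (f t ≟ y) ×-dec (S t Bool.≟ true))
      ... | no nt = ⊥-elim (none (s , y , s∈ , sy , nt))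
      ... | yes (t , ne , refl , t∈) with S⊆Dom⁺ t∈
      ...   | inj₁ dom = t , ne , refl , f-arc dom , t∈
      ...   | inj₂ e   = ⊥-elim (ne e)
    ... | yes (s , y , s∈ , sy , uncovered) with any? (λ d → (Dom d Bool.≟ true) ×-dec (f d ≟ y))
    -- Shifting uses only heads that were in use before, so `y` is still free.
    ...   | no free = inj₁ (assign-matching sy g-arc g-inj
              λ v∈ ne e → let d , d∈ , fd = image v∈ ne in free (d , d∈ , trans fd e))
      where open Shift (Tree.shift T s∈)
    ...   | yes (d , d∈ , fd≡y) with Tree.S T d in Sd
    ...     | true = ⊥-elim (uncovered (d , (λ { refl → not-both d∈ root∉Dom }) , fd≡y , Sd))
    search zero    T bound | yes (s , y , s∈ , sy , _) | yes (d , d∈ , fd≡y) | false =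
      ⊥-elim (1+n≰n (≤-trans (≤-reflexive (+-comm 1 n)) (≤-trans (+-monoˡ-≤ 1 bound)
        (≤-trans (Grow.larger T s∈ sy d∈ fd≡y Sd) (#≤n _)))))
    search (suc k) T bound | yes (s , y , s∈ , sy , _) | yes (d , d∈ , fd≡y) | false =
      search k (Grow.grown T s∈ sy d∈ fd≡y Sd)
        (≤-trans bound (≤-trans (≤-reflexive (trans (sym (+-suc k _)) (cong (k +_) (+-comm 1 _))))
          (+-monoʳ-≤ k (Grow.larger T s∈ sy d∈ fd≡y Sd))))

  matching? : ∀ k (Dom : V → Bool) → Matching (λ v → Dom v ≡ true) → n ≤ k + # Dom → CycleFactor D ⊎ Deficient
  matching? k Dom M bound with any? (λ v → Dom v Bool.≟ false)
  ... | no none = inj₁ record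
        { π = f ; π-inj = λ {u} {v} → f-inj (total u) (total v) ; π-arc = λ v → f-arc (total v) }
    where
    open Matching M
    total : ∀ v → Dom v ≡ true
    total v with Dom v in e
    ... | true  = refl
    ... | false = ⊥-elim (none (v , e))
  matching? zero Dom M bound | yes (x , x∉) =
    ⊥-elim (1+n≰n (≤-trans (≤-reflexive (+-comm 1 n)) (≤-trans (+-monoˡ-≤ 1 bound)
      (≤-trans (#-insert {q = λ _ → true} x (λ _ _ → refl) x∉ refl) (#≤n _)))))
  matching? (suc k) Dom M bound | yes (x , x∉) with Augment.search Dom M x x∉ n (Augment.initial Dom M x x∉) (m≤m+n n _)
  ... | inj₂ deficient = inj₂ deficient
  ... | inj₁ M′ = matching? k Dom′
          (record { f = f ; f-arc = f-arc ∘ Dom⁺ ; f-inj = λ u∈ v∈ → f-inj (Dom⁺ u∈) (Dom⁺ v∈) })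
          (≤-trans bound (≤-trans (≤-reflexive (trans (sym (+-suc k _)) (cong (k +_) (+-comm 1 _))))
            (+-monoʳ-≤ k (#-insert x ⊆Dom′ x∉ (cong (_∨ Dom x) (dec-true (x ≟ x) refl))))))
    where
    open Matching M′
    Dom′ : V → Bool
    Dom′ v = δ x v ∨ Dom v
    Dom⁺ : ∀ {v} → Dom′ v ≡ true → Dom v ≡ true ⊎ v ≡ x
    Dom⁺ {v} e with x ≟ v
    ... | yes p = inj₂ (sym p)
    ... | no _  = inj₁ e
    ⊆Dom′ : ∀ v → Dom v ≡ true → Dom′ v ≡ true
    ⊆Dom′ v e with x ≟ v
    ... | yes _ = refl
    ... | no _  = e

  cycle-factor-or-deficient : CycleFactor D ⊎ Deficient
  cycle-factor-or-deficient = matching? n (λ _ → false)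
    (record { f = id ; f-arc = λ () ; f-inj = λ () }) (m≤m+n n _)

-- Iterates and orbits of a permutation.

iterate : ∀ {n} → (Fin n → Fin n) → ℕ → Fin n → Fin n
iterate π zero    v = v
iterate π (suc k) v = π (iterate π k v)

module Orbit {n} (π : Fin n → Fin n) (π-inj : Injective _≡_ _≡_ π) (v₀ : Fin n) where

  private
    V : Set
    V = Fin n

  iterate-+ : ∀ i j v → iterate π (i + j) v ≡ iterate π i (iterate π j v)
  iterate-+ zero    j v = refl
  iterate-+ (suc i) j v = cong π (iterate-+ i j v)

  iterate-inj : ∀ i → Injective _≡_ _≡_ (iterate π i)
  iterate-inj zero    e = e
  iterate-inj (suc i) e = iterate-inj i (π-inj e)

  difference-period : ∀ {i j} → i < j → iterate π i v₀ ≡ iterate π j v₀ → iterate π (j ∸ i) v₀ ≡ v₀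
  difference-period {i} {j} i<j e = iterate-inj i (begin
    iterate π i (iterate π (j ∸ i) v₀)  ≡⟨ sym (iterate-+ i (j ∸ i) v₀) ⟩
    iterate π (i + (j ∸ i)) v₀          ≡⟨ cong (λ k → iterate π k v₀) (m+[n∸m]≡n (<⇒≤ i<j)) ⟩
    iterate π j v₀                      ≡⟨ sym e ⟩
    iterate π i v₀                      ∎)
    where open ≡-Reasoning

  -- Two of the `n + 1` iterates with exponents `0` to `n` coincide. The period is written `suc p`
  -- to make it positive.
  period : ∃ λ p → suc p ≤ n × iterate π (suc p) v₀ ≡ v₀
  period with i , j , i<j , e ← pigeonhole (n<1+n n) (λ (i : Fin (suc n)) → iterate π (toℕ i) v₀)
    with toℕ j ∸ toℕ i in d≡ | difference-period i<j e
  ... | zero  | _  = ⊥-elim (1+n≰n (≤-trans i<j (m∸n≡0⇒m≤n d≡)))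
  ... | suc p | pe = p , ≤-trans (≤-reflexive (sym d≡)) (≤-trans (m∸n≤m (toℕ j) (toℕ i)) (≤-pred (toℕ<n j))) , pe

  reduce : ∀ {p} → iterate π (suc p) v₀ ≡ v₀ → ∀ k → ∃ λ j → j < suc p × iterate π j v₀ ≡ iterate π k v₀
  reduce pe zero = zero , s≤s z≤n , refl
  reduce {p} pe (suc k) with j , j< , e ← reduce pe k with suc j <? suc p
  ... | yes lt = suc j , lt , cong π e
  -- The exponent has reached the period and wraps around to zero.
  ... | no nlt = zero , s≤s z≤n , trans (sym pe) (cong π (trans (cong (λ i → iterate π i v₀) p≡j) e))
    where
    p≡j : p ≡ j
    p≡j = ≤-antisym (≤-pred (≮⇒≥ nlt)) (≤-pred j<)

  Reach : V → Set
  Reach w = ∃ λ k → iterate π k v₀ ≡ w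

  opaque
    -- Trying exponents below `n` suffices, since some period is at most `n` and `reduce` brings
    -- every exponent below it.
    orbit : V → Bool
    orbit w = does (any? λ (k : Fin n) → iterate π (toℕ k) v₀ ≟ w)

    orbit⇒Reach : ∀ {w} → orbit w ≡ true → Reach w
    orbit⇒Reach {w} e = let k , p = does⇒ (any? λ (k : Fin n) → iterate π (toℕ k) v₀ ≟ w) e in toℕ k , p

    Reach⇒orbit : ∀ {w} → Reach w → orbit w ≡ true
    Reach⇒orbit {w} (k , e) =
      let p , p≤n , pe = period
          j , j< , e′  = reduce pe k
          j<n          = ≤-trans j< p≤n
      in dec-true (any? λ (k : Fin n) → iterate π (toℕ k) v₀ ≟ w)
           (fromℕ< j<n , trans (cong (λ i → iterate π i v₀) (toℕ-fromℕ< j<n)) (trans e′ e))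

  orbit-closed : ∀ v → orbit (π v) ≡ orbit v
  orbit-closed v = ≡-by-true (Reach⇒orbit ∘ back ∘ orbit⇒Reach)
    λ e → Reach⇒orbit (let k , p = orbit⇒Reach e in suc k , cong π p)
    where
    back : Reach (π v) → Reach v
    back (suc k , e) = k , π-inj e
    -- Here `π v` is `v₀` itself, so `v` is the last vertex before the cycle closes.
    back (zero  , e) = let p , _ , pe = period in p , π-inj (trans pe e)

  -- With `x` at exponent `i` at most `p`, another `p ∸ i` steps from `π x` close the cycle at `v₀`,
  -- and `k` more lead to `w`.
  reach-from-π : ∀ {x w} → Reach x → Reach w → ∃ λ m → iterate π m (π x) ≡ w
  reach-from-π {x} {w} (i₀ , ex) (k , ew) with p , _ , pe ← period with i , i< , e ← reduce pe i₀ =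
    k + (p ∸ i) , (begin
      iterate π (k + (p ∸ i)) (π x)                        ≡⟨ cong (iterate π (k + (p ∸ i)) ∘ π) (trans (sym ex) (sym e)) ⟩
      iterate π (k + (p ∸ i)) (iterate π (suc i) v₀)       ≡⟨ sym (iterate-+ (k + (p ∸ i)) (suc i) v₀) ⟩
      iterate π (k + (p ∸ i) + suc i) v₀                   ≡⟨ cong (λ j → iterate π j v₀) exponent ⟩
      iterate π (k + suc p) v₀                             ≡⟨ iterate-+ k (suc p) v₀ ⟩
      iterate π k (iterate π (suc p) v₀)                   ≡⟨ cong (iterate π k) pe ⟩
      iterate π k v₀                                       ≡⟨ ew ⟩
      w                                                    ∎)
    where
    open ≡-Reasoning
    exponent : k + (p ∸ i) + suc i ≡ k + suc p
    exponent = trans (+-assoc k (p ∸ i) (suc i)) (cong (k +_) (trans (+-suc (p ∸ i) i) (cong suc (m∸n+n≡m (≤-pred i<)))))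

  -- Every vertex has an exponent below the period, and distinct vertices have distinct exponents.
  period≥n : (∀ w → orbit w ≡ true) → ∀ q → iterate π (suc q) v₀ ≡ v₀ → n ≤ suc q
  period≥n all q qe = injective⇒≤ {f = λ w → fromℕ< (proj₁ (proj₂ (residue w)))} λ {u} {v} e →
    trans (sym (proj₂ (proj₂ (residue u))))
      (trans (cong (λ i → iterate π i v₀) (fromℕ<-injective _ _ _ _ e)) (proj₂ (proj₂ (residue v))))
    where
    residue : ∀ w → ∃ λ j → j < suc q × iterate π j v₀ ≡ w
    residue w = let k , e = orbit⇒Reach (all w) ; j , j< , e′ = reduce qe k in j , j< , trans e′ e

orbit-full⇒hamiltonian : ∀ {n} (D : Digraph n) (F : CycleFactor D) (v₀ : Fin n) →
  (∀ w → Orbit.orbit (CycleFactor.π F) (CycleFactor.π-inj F) v₀ w ≡ true) → Hamiltonian D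
orbit-full⇒hamiltonian {suc m} D F v₀ all = σ , σ-inj , σ-arc
  where
  open CycleFactor F
  open Orbit π π-inj v₀
  σ : Fin (suc m) → Fin (suc m)
  σ i = iterate π (toℕ i) v₀
  -- A repetition among the first `n` iterates would yield a period below `n`.
  distinct : ∀ {i j : Fin (suc m)} → toℕ i < toℕ j → σ i ≢ σ j
  distinct {i} {j} i<j e with toℕ j ∸ toℕ i in d≡ | difference-period i<j e
  ... | zero  | _  = 1+n≰n (≤-trans i<j (m∸n≡0⇒m≤n d≡))
  ... | suc q | qe = 1+n≰n (≤-trans (toℕ<n j) (≤-trans (period≥n all q qe)
                       (≤-trans (≤-reflexive (sym d≡)) (m∸n≤m (toℕ j) (toℕ i)))))
  σ-inj : Injective _≡_ _≡_ σ
  σ-inj {i} {j} e with <-cmp (toℕ i) (toℕ j)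
  ... | tri< lt _ _ = ⊥-elim (distinct lt e)
  ... | tri≈ _ eq _ = toℕ-injective eq
  ... | tri> _ _ gt = ⊥-elim (distinct gt (sym e))
  n-period : iterate π (suc m) v₀ ≡ v₀
  n-period with p , p≤ , pe ← period = trans (cong (λ k → iterate π k v₀) (≤-antisym (period≥n all p pe) p≤)) pe
  next-iterate : ∀ i → σ (next i) ≡ π (σ i)
  next-iterate i with suc (toℕ i) <? suc m
  ... | yes lt = cong (λ k → iterate π k v₀) (trans (toℕ-fromℕ< (m%n<n (suc (toℕ i)) (suc m))) (m<n⇒m%n≡m lt))
  ... | no nlt = trans (cong (λ k → iterate π k v₀) (trans (toℕ-fromℕ< (m%n<n (suc (toℕ i)) (suc m)))
                   (trans (cong (λ k → k % suc m) last) (n%n≡0 (suc m)))))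
                   (trans (sym n-period) (cong (λ k → iterate π k v₀) (sym last)))
    where
    last : suc (toℕ i) ≡ suc m
    last = ≤-antisym (toℕ<n i) (≮⇒≥ nlt)
  σ-arc : ∀ i → Arc D (σ i) (σ (next i))
  σ-arc i = subst (Arc D (σ i)) (sym (next-iterate i)) (π-arc (σ i))

-- Merging two cycles by exchanging successors.

module Merge {n} (D : Digraph n) (F : CycleFactor D) (v₀ : Fin n) where

  open CycleFactor F
  open Orbit π π-inj v₀

  module _ {x x′ : Fin n} (x∈ : orbit x ≡ true) (x′∉ : orbit x′ ≡ false)
    (xx′ : Arc D x (π x′)) (x′x : Arc D x′ (π x)) where

    -- Precomposing `π` with this transposition exchanges the successors of `x` and `x′` and changes
    -- nothing else.
    transpose : Fin n → Fin n
    transpose v with x ≟ v | x′ ≟ v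
    ... | yes _ | _     = x′
    ... | no _  | yes _ = x
    ... | no _  | no _  = v

    transpose-involutive : ∀ v → transpose (transpose v) ≡ v
    transpose-involutive v with x ≟ v | x′ ≟ v
    ... | yes refl | _ with x ≟ x′ | x′ ≟ x′
    ...   | yes e | _     = sym e
    ...   | no _  | yes _ = refl
    ...   | no _  | no ne = ⊥-elim (ne refl)
    transpose-involutive v | no _ | yes refl with x ≟ x | x′ ≟ x
    ...   | yes _ | _ = refl
    ...   | no ne | _ = ⊥-elim (ne refl)
    transpose-involutive v | no ne | no ne′ with x ≟ v | x′ ≟ v
    ...   | yes e | _     = ⊥-elim (ne e)
    ...   | no _  | yes e = ⊥-elim (ne′ e)
    ...   | no _  | no _  = refl

    π-transpose-arc : ∀ v → Arc D v (π (transpose v))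
    π-transpose-arc v with x ≟ v | x′ ≟ v
    ... | yes refl | _        = xx′
    ... | no _     | yes refl = x′x
    ... | no _     | no _     = π-arc v

    merged : CycleFactor D
    merged = record
      { π = π ∘ transpose
      ; π-inj = λ {u} {v} e → trans (sym (transpose-involutive u))
          (trans (cong transpose (π-inj e)) (transpose-involutive v))
      ; π-arc = π-transpose-arc }

    -- Starting at `π x`, the new permutation follows the old cycle up to `x` before it first
    -- departs from `π`.
    module O′ = Orbit (π ∘ transpose) (CycleFactor.π-inj merged) (π x)

    reach-cycle : ∀ k → O′.Reach (iterate π k (π x))
    reach-cycle zero = zero , refl
    reach-cycle (suc k) with x ≟ iterate π k (π x)
    ... | yes e = zero , cong π e
    ... | no ne with j , e ← reach-cycle k = suc j , cong π (trans (cong transpose e) fixed)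
      where
      in-orbit : ∀ k → orbit (iterate π k (π x)) ≡ true
      in-orbit zero    = trans (orbit-closed x) x∈
      in-orbit (suc k) = trans (orbit-closed _) (in-orbit k)
      fixed : transpose (iterate π k (π x)) ≡ iterate π k (π x)
      fixed with x ≟ iterate π k (π x) | x′ ≟ iterate π k (π x)
      ... | yes e | _     = ⊥-elim (ne e)
      ... | no _  | yes e = ⊥-elim (not-both (in-orbit k) (trans (cong orbit (sym e)) x′∉))
      ... | no _  | no _  = refl

    orbit⊆ : ∀ w → orbit w ≡ true → O′.orbit w ≡ true
    orbit⊆ w w∈ with m , e ← reach-from-π (orbit⇒Reach x∈) (orbit⇒Reach w∈) =
      O′.Reach⇒orbit (subst O′.Reach e (reach-cycle m))

    transpose-x : transpose x ≡ x′
    transpose-x with x ≟ x | x′ ≟ x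
    ... | yes _ | _ = refl
    ... | no ne | _ = ⊥-elim (ne refl)

    πx′∈ : O′.orbit (π x′) ≡ true
    πx′∈ with k , e ← O′.orbit⇒Reach (orbit⊆ x x∈) =
      O′.Reach⇒orbit (suc k , cong π (trans (cong transpose e) transpose-x))

    merged-larger : # orbit + 1 ≤ # O′.orbit
    merged-larger = #-insert (π x′) orbit⊆ (trans (orbit-closed x′) x′∉) πx′∈

-- Degree estimates in bipartite digraphs

-- Each right-hand side is a lower bound for a doubled degree sum; the last summand on the left is its surplus.
gain-all-large : ∀ r t → 2 * (r * (r + t)) + 4 * (r * r) + (r * t + r) ≡ (3 * (r + (r + t)) + 1) * r
gain-all-large = solve-∀

gain-many-small : ∀ q L t → let p = 2 + q; r = p + L; a = r + (r + t) in
  2 * (r * (r + t)) + 4 * (r * (L + 1)) + (2 * (q * q) + 6 * q + 4 + 2 * (q * L) + L + t * L)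
    ≡ 2 * (a + 1) * p + (3 * a + 1) * L
gain-many-small = solve-∀

gain-one-small : ∀ l t → let L = 1 + l; r = 1 + L; a = r + (r + t) in
  2 * (r * (r + t)) + 4 * (L * L + L + 1) + (3 * L + t * L) ≡ 2 * (a + 1) * 1 + (3 * a + 1) * L
gain-one-small = solve-∀

module Bipartite {n} (D : Digraph n) (a : ℕ) (c : Fin n → Bool)
  (bip : ∀ u v → Arc D u v → c u ≢ c v)
  (heavy : ∀ u v → Dominating D u v → 3 * a + 1 ≤ deg D u + deg D v) where

  private
    V : Set
    V = Fin n

  side : Bool → V → Bool
  side b v = does (c v Bool.≟ b)

  A : V → V → ℕ
  A u v = ι (arc D u v)

  deg≡sum : ∀ v → deg D v ≡ sum (A v) + sum (λ w → A w v)
  deg≡sum v = cong₂ _+_ (count≡# (arc D v)) (count≡# (λ w → arc D w v))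

  side⇒ : ∀ {b v} → side b v ≡ true → c v ≡ b
  side⇒ {b} {v} = does⇒ (c v Bool.≟ b)

  ⇒side : ∀ {b v} → c v ≡ b → side b v ≡ true
  ⇒side {b} {v} = dec-true (c v Bool.≟ b)

  arc-side : ∀ {u v} → Arc D u v → c v ≡ not (c u)
  arc-side {u} {v} uv = ¬-not (bip u v uv ∘ sym)

  arc-side′ : ∀ {u v} → Arc D u v → c u ≡ not (c v)
  arc-side′ {u} {v} uv = ¬-not (bip u v uv)

  small : V → Bool
  small v = does (2 * deg D v ≤? 3 * a)

  small-bound : ∀ v → small v ≡ true → 2 * deg D v ≤ 3 * a
  small-bound v = does⇒ (2 * deg D v ≤? 3 * a)

  large-bound : ∀ v → small v ≡ false → 3 * a + 1 ≤ 2 * deg D v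
  large-bound v sv = ≤-trans (≤-reflexive (+-comm (3 * a) 1)) (≰⇒> (does⇒¬ (2 * deg D v ≤? 3 * a) sv))

  small-nondominating : ∀ {u v w} → small u ≡ true → small v ≡ true → Arc D u w → Arc D v w → u ≡ v
  small-nondominating {u} {v} {w} su sv uw vw with u ≟ v
  ... | yes e = e
  ... | no ne = ⊥-elim (1+n≰n (begin
      1 + (3 * a + 3 * a)            ≤⟨ n≤1+n _ ⟩
      2 + (3 * a + 3 * a)            ≡⟨ double (3 * a) ⟩
      2 * (3 * a + 1)                ≤⟨ *-monoʳ-≤ 2 (heavy u v (ne , w , uw , vw)) ⟩
      2 * (deg D u + deg D v)        ≡⟨ *-distribˡ-+ 2 (deg D u) _ ⟩
      2 * deg D u + 2 * deg D v      ≤⟨ +-mono-≤ (small-bound u su) (small-bound v sv) ⟩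
      3 * a + 3 * a                  ∎))
    where
    open ≤-Reasoning
    double : ∀ k → 2 + (k + k) ≡ 2 * (k + 1)
    double = solve-∀

  module Part (C : V → Bool) where

    Cᵇ : Bool → V → Bool
    Cᵇ b v = C v ∧ side b v

    ∑ᵇ : Bool → (V → ℕ) → ℕ
    ∑ᵇ b f = sum λ v → ι (Cᵇ b v) * f v

    outᶜ inᶜ : V → ℕ
    outᶜ u = sum λ w → ι (C w) * A u w
    inᶜ  u = sum λ w → ι (C w) * A w u

    eᵇ : Bool → ℕ
    eᵇ b = ∑ᵇ b outᶜ

    from : Bool → V → ℕ
    from b w = # λ u → Cᵇ b u ∧ arc D u w

    -- The arcs inside `C` that start on side `b` are counted by their heads, which lie on the other
    -- side.
    eᵇ≤∑from : ∀ b → eᵇ b ≤ ∑ᵇ (not b) (from b)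
    eᵇ≤∑from b = begin
      (sum λ u → ι (Cᵇ b u) * outᶜ u)
        ≡⟨ sum-cong-≗ (λ u → *-distribˡ-sum (ι (Cᵇ b u)) (λ w → ι (C w) * A u w)) ⟩
      (sum λ u → sum λ w → ι (Cᵇ b u) * (ι (C w) * A u w))
        ≡⟨ ∑-comm (λ u w → ι (Cᵇ b u) * (ι (C w) * A u w)) ⟩
      (sum λ w → sum λ u → ι (Cᵇ b u) * (ι (C w) * A u w))
        ≤⟨ sum-mono (λ w → sum-mono λ u → pointwise u w) ⟩
      (sum λ w → sum λ u → ι (Cᵇ (not b) w) * ι (Cᵇ b u ∧ arc D u w))
        ≡⟨ sum-cong-≗ (λ w → sym (*-distribˡ-sum (ι (Cᵇ (not b) w)) (λ u → ι (Cᵇ b u ∧ arc D u w)))) ⟩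
      ∑ᵇ (not b) (from b) ∎
      where
      open ≤-Reasoning
      pointwise : ∀ u w → ι (Cᵇ b u) * (ι (C w) * A u w) ≤ ι (Cᵇ (not b) w) * ι (Cᵇ b u ∧ arc D u w)
      pointwise u w = ι*-≤ (Cᵇ b u) λ bu → ι*-≤ (C w) λ Cw → ι-≤ (arc D u w) λ uw →
        let cu = side⇒ (proj₂ (∧-true {C u} bu))
        in *-mono-≤ (ι-true (true-∧ Cw (⇒side (trans (arc-side uw) (cong not cu)))))
                    (ι-true (true-∧ bu uw))

    module Sized (r : ℕ) (size : ∀ b → # (Cᵇ b) ≡ r) where

      open ≤-Reasoning

      e-bound : ∀ b k → (∀ w → from b w ≤ k) → eᵇ b ≤ r * k
      e-bound b k h = begin
        eᵇ b                                       ≤⟨ eᵇ≤∑from b ⟩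
        ∑ᵇ (not b) (from b)                        ≤⟨ sum-mono (λ w → *-monoʳ-≤ (ι (Cᵇ (not b) w)) (h w)) ⟩
        ∑ᵇ (not b) (λ _ → k)                       ≡⟨ sum-weight (Cᵇ (not b)) k ⟩
        # (Cᵇ (not b)) * k                         ≡⟨ cong (_* k) (size (not b)) ⟩
        r * k                                      ∎

      from≤r : ∀ b w → from b w ≤ r
      from≤r b w = ≤-trans (#-mono {p = λ u → Cᵇ b u ∧ arc D u w} {q = Cᵇ b} λ u e → proj₁ (∧-true {Cᵇ b u} e)) (≤-reflexive (size b))

    module Excess (min-deg : ∀ v → a + 1 ≤ deg D v)
      (π : V → V) (π-arc : ∀ v → Arc D v (π v)) (closed : ∀ v → C (π v) ≡ C v)
      (r t : ℕ) (a≡ : a ≡ r + (r + t)) (2≤r : 2 ≤ r)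
      (size : ∀ b → # (Cᵇ b) ≡ r) (b : Bool) where

      open ≤-Reasoning
      open Sized r size

      ∑2deg : ℕ
      ∑2deg = ∑ᵇ b (λ v → 2 * deg D v)

      S Lg : V → Bool
      S  v = small v ∧ Cᵇ b v
      Lg v = not (small v) ∧ Cᵇ b v

      -- The two sides together contradict the upper bound `total`, which doubled reads
      -- `4 * E + 4 * r * (r + t)` for `E` arcs inside `C`. Doubling keeps the threshold `3a / 2`
      -- integral.
      Target : Set
      Target = 2 * (r * (r + t)) + 4 * eᵇ b < ∑2deg

      S+Lg≡r : # S + # Lg ≡ r
      S+Lg≡r = trans (sym (#-split (Cᵇ b) small)) (size b)

      -- At most one small vertex has an arc to `w`, since two of them would dominate.
      from≤Lg : ∀ w → from b w ≤ # Lg + 1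
      from≤Lg w = begin
        from b w ≡⟨ #-split (λ u → Cᵇ b u ∧ arc D u w) small ⟩
        # (λ u → small u ∧ (Cᵇ b u ∧ arc D u w)) + # (λ u → not (small u) ∧ (Cᵇ b u ∧ arc D u w))
                 ≤⟨ +-mono-≤ (#-unique {p = λ u → small u ∧ (Cᵇ b u ∧ arc D u w)} λ u v eu ev →
                      let su , eu′ = ∧-true {small u} eu ; sv , ev′ = ∧-true {small v} ev
                      in small-nondominating su sv (proj₂ (∧-true {Cᵇ b u} eu′)) (proj₂ (∧-true {Cᵇ b v} ev′)))
                    (#-mono {p = λ u → not (small u) ∧ (Cᵇ b u ∧ arc D u w)} {q = Lg} λ u e →
                      let nu , e′ = ∧-true {not (small u)} e
                      in true-∧ nu (proj₁ (∧-true {Cᵇ b u} e′))) ⟩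
        1 + # Lg ≡⟨ +-comm 1 (# Lg) ⟩
        # Lg + 1 ∎

      deg-bound : 2 * (a + 1) * # S + (3 * a + 1) * # Lg ≤ ∑2deg
      deg-bound = begin
        2 * (a + 1) * # S + (3 * a + 1) * # Lg
          ≡⟨ cong₂ _+_ (trans (*-comm _ (# S)) (sym (sum-weight S _))) (trans (*-comm _ (# Lg)) (sym (sum-weight Lg _))) ⟩
        sum (λ v → ι (S v) * (2 * (a + 1))) + sum (λ v → ι (Lg v) * (3 * a + 1))
          ≤⟨ sum-mono-+ {f = λ v → ι (S v) * (2 * (a + 1))} pointwise ⟩
        ∑2deg ∎
        where
        pointwise : ∀ v → ι (S v) * (2 * (a + 1)) + ι (Lg v) * (3 * a + 1) ≤ ι (Cᵇ b v) * (2 * deg D v)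
        pointwise v with small v in sv
        ... | true  = ≤-trans (≤-reflexive (+-identityʳ _)) (*-monoʳ-≤ (ι (Cᵇ b v)) (*-monoʳ-≤ 2 (min-deg v)))
        ... | false = *-monoʳ-≤ (ι (Cᵇ b v)) (large-bound v sv)

      -- Common end of the cases: a bound `E` on the arcs inside `C` and an identity whose surplus
      -- `suc k` is visibly positive.
      conclude : ∀ {E X Y} k → eᵇ b ≤ E → 2 * (r * (r + t)) + 4 * E + suc k ≡ X → X ≡ Y → Y ≤ ∑2deg → Target
      conclude {E} k e≤E refl refl Y≤ = begin-strict
        2 * (r * (r + t)) + 4 * eᵇ b      ≤⟨ +-monoʳ-≤ (2 * (r * (r + t))) (*-monoʳ-≤ 4 e≤E) ⟩
        2 * (r * (r + t)) + 4 * E         <⟨ m<m+n (2 * (r * (r + t)) + 4 * E) (s≤s z≤n) ⟩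
        2 * (r * (r + t)) + 4 * E + suc k ≤⟨ Y≤ ⟩
        ∑2deg                             ∎

      -- If the degrees on this side average at least `(3a + 1) / 2`, the trivial bound of `r * r`
      -- arcs is enough.
      from-average : (3 * a + 1) * r ≤ ∑2deg → Target
      from-average h = conclude (r * t + (r ∸ 1)) (e-bound b r (from≤r b))
        (trans (cong (2 * (r * (r + t)) + 4 * (r * r) +_) lem) (gain-all-large r t))
        (cong (λ z → (3 * z + 1) * r) (sym a≡)) h
        where
        lem : suc (r * t + (r ∸ 1)) ≡ r * t + r
        lem = trans (sym (+-suc (r * t) (r ∸ 1))) (cong (r * t +_) (m+[n∸m]≡n (≤-trans (s≤s z≤n) 2≤r)))

      no-small : # S ≡ 0 → Target
      no-small p0 = from-average (begin
        (3 * a + 1) * r          ≡⟨ cong ((3 * a + 1) *_) (trans (sym S+Lg≡r) (cong (_+ # Lg) p0)) ⟩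
        (3 * a + 1) * # Lg       ≤⟨ m≤n+m _ (2 * (a + 1) * # S) ⟩
        _                        ≤⟨ deg-bound ⟩
        ∑2deg                    ∎)

      -- With two or more small vertices, the arcs lost by `from≤Lg` outweigh the weaker degree
      -- bound `a + 1`.
      many-small : ∀ q → # S ≡ 2 + q → Target
      many-small q p≡ = conclude _ (e-bound b _ from≤Lg) refl
        (trans (cong (λ z → 2 * (z * (z + t)) + 4 * (z * (# Lg + 1)) + suc k) r≡)
          (trans (cong (2 * (ρ * (ρ + t)) + 4 * (ρ * (# Lg + 1)) +_) (lem q (# Lg) t))
          (trans (gain-many-small q (# Lg) t)
            (cong₂ (λ z p → 2 * (z + 1) * p + (3 * z + 1) * # Lg)
               (trans (cong (λ z → z + (z + t)) (sym r≡)) (sym a≡)) (sym p≡)))))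
        deg-bound
        where
        ρ = 2 + q + # Lg
        k = 2 * (q * q) + 6 * q + 3 + 2 * (q * # Lg) + # Lg + t * # Lg
        r≡ : r ≡ ρ
        r≡ = trans (sym S+Lg≡r) (cong (_+ # Lg) p≡)
        lem : ∀ q L t → suc (2 * (q * q) + 6 * q + 3 + 2 * (q * L) + L + t * L) ≡ 2 * (q * q) + 6 * q + 4 + 2 * (q * L) + L + t * L
        lem = solve-∀

      -- One small vertex `x` makes `from≤Lg` as weak as the trivial bound `r`. The arc from `x` to
      -- `π x` helps instead: either `π x` has another in-neighbour on this side of `C`, whose
      -- degree is then large, or it has lost almost all possible in-arcs.
      module OneSmall (p≡1 : # S ≡ 1) where

        x : V
        x = proj₁ (#≥1⇒∃ {p = S} (≤-reflexive (sym p≡1)))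

        Sx : S x ≡ true
        Sx = proj₂ (#≥1⇒∃ {p = S} (≤-reflexive (sym p≡1)))

        Cᵇx : Cᵇ b x ≡ true
        Cᵇx = proj₂ (∧-true {small x} Sx)

        only : ∀ {v} → Cᵇ b v ≡ true → x ≢ v → small v ≡ false
        only {v} bv ne with small v in sv
        ... | false = refl
        ... | true  = ⊥-elim (1+n≰n (≤-trans (∃≢⇒#≥2 ne Sx (true-∧ sv bv)) (≤-reflexive p≡1)))

        r≡ : r ≡ 1 + # Lg
        r≡ = trans (sym S+Lg≡r) (cong (_+ # Lg) p≡1)

        K : ℕ
        K = (3 * a + 1) ∸ 2 * deg D x

        x+K : 2 * deg D x + K ≡ 3 * a + 1
        x+K = m+[n∸m]≡n (≤-trans (small-bound x (proj₁ (∧-true {small x} Sx))) (m≤m+n (3 * a) 1))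

        -- The degree deficit K of x below the average is compensated by its partner.
        partner-inside : ∀ y → x ≢ y → Cᵇ b y ≡ true → Arc D y (π x) → Target
        partner-inside y x≢y by yπx = from-average (+-cancelʳ-≤ K _ _ (begin
          (3 * a + 1) * r + K
            ≡⟨ cong₂ _+_ (trans (*-comm _ r) (trans (cong (_* (3 * a + 1)) (sym (size b))) (sym (sum-weight (Cᵇ b) _)))) (sym (sum-δ y (λ _ → K))) ⟩
          sum (λ v → ι (Cᵇ b v) * (3 * a + 1)) + sum (λ v → ι (δ y v) * K)
            ≡⟨ sym (∑-distrib-+ (λ v → ι (Cᵇ b v) * (3 * a + 1)) (λ v → ι (δ y v) * K)) ⟩
          sum (λ v → ι (Cᵇ b v) * (3 * a + 1) + ι (δ y v) * K)
            ≤⟨ sum-mono pointwise ⟩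
          sum (λ v → ι (Cᵇ b v) * (2 * deg D v) + ι (δ x v) * K)
            ≡⟨ ∑-distrib-+ (λ v → ι (Cᵇ b v) * (2 * deg D v)) (λ v → ι (δ x v) * K) ⟩
          ∑2deg + sum (λ v → ι (δ x v) * K)
            ≡⟨ cong (∑2deg +_) (sum-δ x (λ _ → K)) ⟩
          ∑2deg + K ∎))
          where
          double : ∀ k → (k + k) ≡ 2 * k
          double = solve-∀
          partner : 3 * a + 1 + K ≤ 2 * deg D y
          partner = +-cancelˡ-≤ (2 * deg D x) _ _ (begin
            2 * deg D x + (3 * a + 1 + K)    ≡⟨ swap (2 * deg D x) (3 * a + 1) K ⟩
            3 * a + 1 + (2 * deg D x + K)    ≡⟨ cong (3 * a + 1 +_) x+K ⟩
            3 * a + 1 + (3 * a + 1)          ≡⟨ double (3 * a + 1) ⟩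
            2 * (3 * a + 1)                  ≤⟨ *-monoʳ-≤ 2 (heavy x y (x≢y , π x , π-arc x , yπx)) ⟩
            2 * (deg D x + deg D y)          ≡⟨ *-distribˡ-+ 2 (deg D x) _ ⟩
            2 * deg D x + 2 * deg D y        ∎)
            where
            swap : ∀ i j k → i + (j + k) ≡ j + (i + k)
            swap = solve-∀
          pointwise : ∀ v → ι (Cᵇ b v) * (3 * a + 1) + ι (δ y v) * K ≤ ι (Cᵇ b v) * (2 * deg D v) + ι (δ x v) * K
          pointwise v with x ≟ v | y ≟ v
          ... | yes refl | yes refl = ⊥-elim (x≢y refl)
          ... | yes refl | no _ rewrite Cᵇx = ≤-reflexive (trans (+-identityʳ _) (trans (*-identityˡ _)
                (trans (sym x+K) (cong₂ _+_ (sym (*-identityˡ _)) (sym (*-identityˡ K))))))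
          ... | no _ | yes refl rewrite by = begin
                1 * (3 * a + 1) + 1 * K   ≡⟨ cong₂ _+_ (*-identityˡ (3 * a + 1)) (*-identityˡ K) ⟩
                3 * a + 1 + K             ≤⟨ partner ⟩
                2 * deg D y               ≡⟨ sym (trans (+-identityʳ (1 * (2 * deg D y))) (*-identityˡ (2 * deg D y))) ⟩
                1 * (2 * deg D y) + 0     ∎
          ... | no x≢v | no _ = +-monoˡ-≤ 0 (ι*-mono (Cᵇ b v) λ bv → large-bound v (only bv x≢v))

        -- Here x is the only in-neighbour of π x inside C.
        no-partner-inside : (∀ y → x ≢ y → Cᵇ b y ≡ true → ¬ Arc D y (π x)) → Target
        no-partner-inside none with # Lg in L≡
        ... | zero  = ⊥-elim (1+n≰n (≤-trans 2≤r (≤-reflexive (trans r≡ (cong suc L≡)))))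
        ... | suc l = conclude _ e≤ refl
          (trans (cong (λ z → 2 * (z * (z + t)) + 4 * (L * L + L + 1) + suc k) r≡ρ)
            (trans (cong (2 * (ρ * (ρ + t)) + 4 * (L * L + L + 1) +_) (lem l t))
            (trans (gain-one-small l t)
              (cong (λ z → 2 * (z + 1) * 1 + (3 * z + 1) * L)
                (trans (cong (λ z → z + (z + t)) (sym r≡ρ)) (sym a≡))))))
          (≤-trans (≤-reflexive (cong₂ (λ p q → 2 * (a + 1) * p + (3 * a + 1) * q) (sym p≡1) (sym L≡))) deg-bound)
          where
          L ρ k : ℕ
          L = 1 + l
          ρ = 1 + L
          k = 3 * l + 2 + t * L
          r≡ρ : r ≡ ρ
          r≡ρ = trans r≡ (cong suc L≡)
          lem : ∀ l t → suc (3 * l + 2 + t * (1 + l)) ≡ 3 * (1 + l) + t * (1 + l)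
          lem = solve-∀
          Cπx : Cᵇ (not b) (π x) ≡ true
          Cπx = true-∧ (trans (closed x) (proj₁ (∧-true {C x} Cᵇx)))
                  (⇒side (trans (arc-side (π-arc x)) (cong not (side⇒ (proj₂ (∧-true {C x} Cᵇx))))))
          from-πx : from b (π x) ≤ 1
          from-πx = #-unique λ u v eu ev → trans (sym (is-x u eu)) (is-x v ev)
            where
            is-x : ∀ u → Cᵇ b u ∧ arc D u (π x) ≡ true → x ≡ u
            is-x u e with x ≟ u
            ... | yes q = q
            ... | no ne = let bu , uπx = ∧-true e in ⊥-elim (none u ne bu uπx)
          pointwise : ∀ w → ι (Cᵇ (not b) w) * from b w + ι (δ (π x) w) * L ≤ ι (Cᵇ (not b) w) * r
          pointwise w with π x ≟ w
          ... | yes refl rewrite Cπx = begin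
                1 * from b (π x) + 1 * L  ≡⟨ cong₂ _+_ (*-identityˡ _) (*-identityˡ L) ⟩
                from b (π x) + L          ≤⟨ +-monoˡ-≤ L from-πx ⟩
                1 + L                     ≡⟨ sym r≡ρ ⟩
                r                         ≡⟨ sym (*-identityˡ r) ⟩
                1 * r                     ∎
          ... | no _ = ≤-trans (≤-reflexive (+-identityʳ _)) (*-monoʳ-≤ (ι (Cᵇ (not b) w)) (from≤r b w))
          square : ∀ L → (1 + L) * (1 + L) ≡ L * L + L + 1 + L
          square = solve-∀
          -- Of the `r` possible arcs into `π x` at most one is present, so `r * r` drops by `L`,
          -- where `r` is `1 + L`.
          e≤ : eᵇ b ≤ L * L + L + 1
          e≤ = +-cancelʳ-≤ L _ _ (begin
            eᵇ b + L
              ≤⟨ +-mono-≤ (eᵇ≤∑from b) (≤-reflexive (sym (sum-δ (π x) (λ _ → L)))) ⟩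
            ∑ᵇ (not b) (from b) + sum (λ w → ι (δ (π x) w) * L)
              ≤⟨ sum-mono-+ pointwise ⟩
            ∑ᵇ (not b) (λ _ → r)     ≡⟨ sum-weight (Cᵇ (not b)) r ⟩
            # (Cᵇ (not b)) * r       ≡⟨ cong (_* r) (size (not b)) ⟩
            r * r                    ≡⟨ cong (λ z → z * z) r≡ρ ⟩
            ρ * ρ                    ≡⟨ square L ⟩
            L * L + L + 1 + L        ∎)

        one-small : Target
        one-small with any? (λ y → ¬? (x ≟ y) ×-dec (Cᵇ b y Bool.≟ true) ×-dec (arc D y (π x) Bool.≟ true))
        ... | yes (y , ne , by , yπx) = partner-inside y ne by yπx
        ... | no none = no-partner-inside λ y ne by yπx → none (y , ne , by , yπx)

      excess : Target
      excess = go (# S) refl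
        where
        go : ∀ p → # S ≡ p → Target
        go 0             e = no-small e
        go 1             e = OneSmall.one-small e
        go (suc (suc q)) e = many-small q e

-- Unions of cycles that admit no merge.

module Balanced {n} (D : Digraph n) (a : ℕ) (c : Fin n → Bool)
  (bip : ∀ u v → Arc D u v → c u ≢ c v)
  (heavy : ∀ u v → Dominating D u v → 3 * a + 1 ≤ deg D u + deg D v)
  (side-size : ∀ b → # (Bipartite.side D a c bip heavy b) ≡ a) where

  open Bipartite D a c bip heavy

  private
    V : Set
    V = Fin n

  open ≤-Reasoning

  out≤ : ∀ v → # (arc D v) ≤ a
  out≤ v = ≤-trans (#-mono {q = side (not (c v))} λ w e → ⇒side (arc-side e)) (≤-reflexive (side-size _))

  in≤ : ∀ v → # (λ w → arc D w v) ≤ a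
  in≤ v = ≤-trans (#-mono {q = side (not (c v))} λ w e → ⇒side (arc-side′ e)) (≤-reflexive (side-size _))

  -- Both the out-degree and the in-degree are at most `a`, so neither can miss a vertex of the
  -- opposite side.
  deg-full : ∀ {v w} → 2 * a ≤ deg D v → c w ≡ not (c v) → Arc D v w × Arc D w v
  deg-full {v} {w} full cw = out , inn
    where
    full′ : 2 * a ≤ # (arc D v) + # (λ w → arc D w v)
    full′ = ≤-trans full (≤-reflexive (deg≡sum v))
    double : ∀ k → 2 * k ≡ k + k
    double = solve-∀
    out : Arc D v w
    out with arc D v w in e
    ... | true  = refl
    ... | false = ⊥-elim (1+n≰n (begin
      1 + 2 * a                                 ≤⟨ s≤s full′ ⟩
      1 + (# (arc D v) + # (λ w → arc D w v))   ≡⟨ cong (_+ # (λ w → arc D w v)) (+-comm 1 (# (arc D v))) ⟩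
      # (arc D v) + 1 + # (λ w → arc D w v)
        ≤⟨ +-mono-≤ (≤-trans (#-insert {q = side (not (c v))} w (λ u f → ⇒side (arc-side f)) e (⇒side cw)) (≤-reflexive (side-size _))) (in≤ v) ⟩
      a + a                                     ≡⟨ sym (double a) ⟩
      2 * a                                     ∎))
    inn : Arc D w v
    inn with arc D w v in e
    ... | true  = refl
    ... | false = ⊥-elim (1+n≰n (begin
      1 + 2 * a                                 ≤⟨ s≤s full′ ⟩
      1 + (# (arc D v) + # (λ w → arc D w v))   ≡⟨ +-comm 1 _ ⟩
      # (arc D v) + # (λ w → arc D w v) + 1     ≡⟨ +-assoc (# (arc D v)) _ 1 ⟩
      # (arc D v) + (# (λ w → arc D w v) + 1)
        ≤⟨ +-mono-≤ (out≤ v) (≤-trans (#-insert {q = side (not (c v))} w (λ u f → ⇒side (arc-side′ f)) e (⇒side cw)) (≤-reflexive (side-size _))) ⟩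
      a + a                                     ≡⟨ sym (double a) ⟩
      2 * a                                     ∎))

  -- The equation `a≡` says that `C` holds at most half of each side; `t` is `a - 2r`.
  module NoMerge (min-deg : ∀ v → a + 1 ≤ deg D v)
    (π : V → V) (π-inj : Injective _≡_ _≡_ π) (π-arc : ∀ v → Arc D v (π v))
    (C : V → Bool) (closed : ∀ v → C (π v) ≡ C v)
    (unmergeable : ∀ {u v} → C u ≡ true → C v ≡ false → Arc D u (π v) → Arc D v (π u) → ⊥)
    (r t : ℕ) (a≡ : a ≡ r + (r + t)) (1≤r : 1 ≤ r)
    (size : ∀ b → # (λ v → C v ∧ side b v) ≡ r) where

    open Part C
    open Sized r size

    R : ℕ
    R = r + t

    co-size : ∀ b → # (λ v → not (C v) ∧ side b v) ≡ R
    co-size b = +-cancelˡ-≡ r _ _ (trans (cong (_+ # (λ v → not (C v) ∧ side b v)) (sym (size b)))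
      (trans (sym (#-split (side b) C)) (trans (side-size b) a≡)))

    out̄ in̄ : V → ℕ
    out̄ u = sum λ w → ι (not (C w)) * A u w
    in̄  u = sum λ w → ι (not (C w)) * A w u

    gap : V → V → Bool
    gap u w = not (C w) ∧ (side (c u) w ∧ (not (arc D u (π w)) ∧ not (arc D w (π u))))

    same-side : ∀ {u w} → Arc D u (π w) → side (c u) w ≡ true
    same-side {u} {w} e = ⇒side (trans (arc-side′ (π-arc w)) (sym (arc-side′ e)))

    same-side′ : ∀ {u w} → Arc D w (π u) → side (c u) w ≡ true
    same-side′ {u} {w} e = ⇒side (trans (arc-side′ e) (sym (arc-side′ (π-arc u))))

    -- For each w outside C, at most one of u → π w and w → π u is an arc; w with neither is counted by gap u.
    cross : ∀ u → C u ≡ true → out̄ u + in̄ (π u) + # (gap u) ≤ R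
    cross u Cu = begin
      out̄ u + in̄ (π u) + # (gap u)
        -- Out-arcs of `u` are indexed by the predecessor under `π` of their head, so that `u → π w`
        -- and `w → π u` are compared at the same `w`.
        ≤⟨ +-monoˡ-≤ (# (gap u)) (+-monoˡ-≤ (in̄ (π u)) (sum-reindex π-inj (λ w → ι (not (C w)) * A u w))) ⟩
      sum f + sum g + # (gap u)
        ≡⟨ cong (_+ # (gap u)) (sym (∑-distrib-+ f g)) ⟩
      sum (λ w → f w + g w) + # (gap u)
        ≤⟨ sum-mono-+ {f = λ w → f w + g w} {f′ = λ w → ι (gap u w)} pointwise ⟩
      # (λ v → not (C v) ∧ side (c u) v)
        ≡⟨ co-size (c u) ⟩
      R ∎
      where
      f g : V → ℕ
      f w = ι (not (C (π w))) * A u (π w)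
      g w = ι (not (C w)) * A w (π u)
      pointwise : ∀ w → f w + g w + ι (gap u w) ≤ ι (not (C w) ∧ side (c u) w)
      pointwise w rewrite closed w with C w in Cw
      ... | true = z≤n
      ... | false with arc D u (π w) in uw | arc D w (π u) in wu | side (c u) w in s
      ... | true  | true  | _     = ⊥-elim (unmergeable Cu Cw uw wu)
      ... | true  | false | true  = ≤-refl
      ... | false | true  | true  = ≤-refl
      ... | false | false | true  = ≤-refl
      ... | false | false | false = z≤n
      ... | true  | false | false = ⊥-elim (not-both (same-side uw) s)
      ... | false | true  | false = ⊥-elim (not-both (same-side′ wu) s)

    ∑ᶜ : (V → ℕ) → ℕ
    ∑ᶜ f = sum λ u → ι (C u) * f u

    ∑ᶜ-mono : ∀ {f g} → (∀ u → C u ≡ true → f u ≤ g u) → ∑ᶜ f ≤ ∑ᶜ g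
    ∑ᶜ-mono h = sum-mono λ u → ι*-mono (C u) (h u)

    ∑ᶜ-+ : ∀ f g → ∑ᶜ (λ u → f u + g u) ≡ ∑ᶜ f + ∑ᶜ g
    ∑ᶜ-+ f g = trans (sum-cong-≗ λ u → *-distribˡ-+ (ι (C u)) (f u) (g u)) (∑-distrib-+ (λ u → ι (C u) * f u) _)

    ∑ᶜ-split : ∀ f → ∑ᶜ f ≡ ∑ᵇ true f + ∑ᵇ false f
    ∑ᶜ-split f = trans (sum-cong-≗ λ u → pointwise (C u) (c u) (f u)) (∑-distrib-+ (λ u → ι (Cᵇ true u) * f u) _)
      where
      pointwise : ∀ x y k → ι x * k ≡ ι (x ∧ does (y Bool.≟ true)) * k + ι (x ∧ does (y Bool.≟ false)) * k
      pointwise true  true  k = sym (+-identityʳ _)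
      pointwise true  false k = refl
      pointwise false _     k = refl

    ∑ᶜ-const : ∀ k → ∑ᶜ (λ _ → k) ≡ (r + r) * k
    ∑ᶜ-const k = trans (∑ᶜ-split (λ _ → k)) (trans
      (cong₂ _+_ (trans (sum-weight (Cᵇ true) k) (cong (_* k) (size true)))
                 (trans (sum-weight (Cᵇ false) k) (cong (_* k) (size false))))
      (sym (*-distribʳ-+ k r r)))

    E : ℕ
    E = eᵇ true + eᵇ false

    ∑outᶜ : ∑ᶜ outᶜ ≡ E
    ∑outᶜ = ∑ᶜ-split outᶜ

    ∑inᶜ : ∑ᶜ inᶜ ≡ ∑ᶜ outᶜ
    ∑inᶜ = begin-equality
      (sum λ u → ι (C u) * inᶜ u)
        ≡⟨ sum-cong-≗ (λ u → *-distribˡ-sum (ι (C u)) (λ w → ι (C w) * A w u)) ⟩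
      (sum λ u → sum λ w → ι (C u) * (ι (C w) * A w u))
        ≡⟨ ∑-comm (λ u w → ι (C u) * (ι (C w) * A w u)) ⟩
      (sum λ w → sum λ u → ι (C u) * (ι (C w) * A w u))
        ≡⟨ sum-cong-≗ (λ w → sum-cong-≗ λ u → swap (ι (C u)) (ι (C w)) (A w u)) ⟩
      (sum λ w → sum λ u → ι (C w) * (ι (C u) * A w u))
        ≡⟨ sum-cong-≗ (λ w → sym (*-distribˡ-sum (ι (C w)) (λ u → ι (C u) * A w u))) ⟩
      (sum λ w → ι (C w) * outᶜ w) ∎
      where
      swap : ∀ x y z → x * (y * z) ≡ y * (x * z)
      swap = solve-∀

    ∑gap : ℕ
    ∑gap = ∑ᶜ (λ u → # (gap u))

    -- `cross` treats out-arcs of `u` and in-arcs of `π u`; as `π` permutes `C`, summation restores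
    -- the in-arcs of `u`. The gaps are kept because the case `r ≡ 1` needs them to vanish.
    ∑outer : ∑ᶜ (λ u → out̄ u + in̄ u) + ∑gap ≤ (r + r) * R
    ∑outer = begin
      ∑ᶜ (λ u → out̄ u + in̄ u) + ∑gap        ≡⟨ cong (_+ ∑gap) (∑ᶜ-+ out̄ in̄) ⟩
      ∑ᶜ out̄ + ∑ᶜ in̄ + ∑gap                 ≤⟨ +-monoˡ-≤ ∑gap (+-monoʳ-≤ (∑ᶜ out̄) reindex) ⟩
      ∑ᶜ out̄ + ∑ᶜ (in̄ ∘ π) + ∑gap           ≡⟨ cong (_+ ∑gap) (sym (∑ᶜ-+ out̄ (in̄ ∘ π))) ⟩
      ∑ᶜ (λ u → out̄ u + in̄ (π u)) + ∑gap    ≡⟨ sym (∑ᶜ-+ (λ u → out̄ u + in̄ (π u)) (λ u → # (gap u))) ⟩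
      ∑ᶜ (λ u → out̄ u + in̄ (π u) + # (gap u)) ≤⟨ ∑ᶜ-mono cross ⟩
      ∑ᶜ (λ _ → R)                           ≡⟨ ∑ᶜ-const R ⟩
      (r + r) * R                            ∎
      where
      reindex : ∑ᶜ in̄ ≤ ∑ᶜ (in̄ ∘ π)
      reindex = ≤-trans (sum-reindex π-inj (λ u → ι (C u) * in̄ u))
        (≤-reflexive (sum-cong-≗ λ u → cong (λ b → ι b * in̄ (π u)) (closed u)))

    deg-split : ∀ v → deg D v ≡ outᶜ v + inᶜ v + (out̄ v + in̄ v)
    deg-split v = trans (deg≡sum v) (trans (cong₂ _+_ (part (A v)) (part (λ w → A w v))) (interchange (outᶜ v) _ _ _))
      where
      interchange : ∀ i j k l → i + j + (k + l) ≡ i + k + (j + l)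
      interchange = solve-∀
      pointwise : ∀ x k → k ≡ ι x * k + ι (not x) * k
      pointwise true  k = sym (trans (+-identityʳ (1 * k)) (*-identityˡ k))
      pointwise false k = sym (*-identityˡ k)
      part : ∀ f → sum f ≡ sum (λ w → ι (C w) * f w) + sum (λ w → ι (not (C w)) * f w)
      part f = trans (sum-cong-≗ λ w → pointwise (C w) (f w)) (∑-distrib-+ (λ w → ι (C w) * f w) _)

    total : ∑ᶜ (deg D) + ∑gap ≤ 2 * E + (r + r) * R
    total = begin
      ∑ᶜ (deg D) + ∑gap
        ≡⟨ cong (_+ ∑gap) (trans (sum-cong-≗ λ v → cong (ι (C v) *_) (deg-split v)) (∑ᶜ-+ (λ v → outᶜ v + inᶜ v) _)) ⟩
      ∑ᶜ (λ v → outᶜ v + inᶜ v) + ∑ᶜ (λ v → out̄ v + in̄ v) + ∑gap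
        ≡⟨ +-assoc (∑ᶜ (λ v → outᶜ v + inᶜ v)) _ ∑gap ⟩
      ∑ᶜ (λ v → outᶜ v + inᶜ v) + (∑ᶜ (λ v → out̄ v + in̄ v) + ∑gap)
        ≤⟨ +-mono-≤ (≤-reflexive inner) ∑outer ⟩
      2 * E + (r + r) * R ∎
      where
      double : ∀ k → k + k ≡ 2 * k
      double = solve-∀
      inner : ∑ᶜ (λ v → outᶜ v + inᶜ v) ≡ 2 * E
      inner = trans (∑ᶜ-+ outᶜ inᶜ) (trans (cong₂ _+_ ∑outᶜ (trans ∑inᶜ ∑outᶜ)) (double E))

    r≥2-impossible : 2 ≤ r → ⊥
    r≥2-impossible 2≤r = <-irrefl refl (begin-strict
      2 * (2 * E + (r + r) * R)                           ≡⟨ rearrange r R (eᵇ true) (eᵇ false) ⟩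
      (2 * (r * R) + 4 * eᵇ true) + (2 * (r * R) + 4 * eᵇ false)
        <⟨ +-mono-< (excess true) (excess false) ⟩
      ∑ᵇ true (λ v → 2 * deg D v) + ∑ᵇ false (λ v → 2 * deg D v)
                                                          ≡⟨ sym (∑ᶜ-split (λ v → 2 * deg D v)) ⟩
      ∑ᶜ (λ v → 2 * deg D v)                              ≡⟨ sum-cong-≗ (λ v → swap (ι (C v)) 2 (deg D v)) ⟩
      sum (λ v → 2 * (ι (C v) * deg D v))                 ≡⟨ sym (*-distribˡ-sum 2 (λ v → ι (C v) * deg D v)) ⟩
      2 * ∑ᶜ (deg D)                                      ≤⟨ *-monoʳ-≤ 2 (≤-trans (m≤m+n _ ∑gap) total) ⟩
      2 * (2 * E + (r + r) * R)                           ∎)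
      where
      open Excess min-deg π π-arc closed r t a≡ 2≤r size
      rearrange : ∀ r R x y → 2 * (2 * (x + y) + (r + r) * R) ≡ (2 * (r * R) + 4 * x) + (2 * (r * R) + 4 * y)
      rearrange = solve-∀
      swap : ∀ x y z → x * (y * z) ≡ y * (x * z)
      swap = solve-∀

    module Digon (r≡1 : r ≡ 1) where

      a≡2+t : a ≡ 2 + t
      a≡2+t = trans a≡ (cong (λ z → z + (z + t)) r≡1)

      E≤2 : E ≤ 2
      E≤2 = +-mono-≤ (e≤1 true) (e≤1 false)
        where
        e≤1 : ∀ b → eᵇ b ≤ 1
        e≤1 b = ≤-trans (e-bound b r (from≤r b)) (≤-reflexive (cong (λ z → z * z) r≡1))

      ∑deg-lower : ∀ u → C u ≡ true → (r + r) * (a + 1) + (deg D u ∸ (a + 1)) ≤ ∑ᶜ (deg D)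
      ∑deg-lower u Cu = begin
        (r + r) * (a + 1) + (deg D u ∸ (a + 1))
          ≡⟨ cong₂ _+_ (sym (∑ᶜ-const (a + 1))) (sym (sum-δ u (λ v → deg D v ∸ (a + 1)))) ⟩
        ∑ᶜ (λ _ → a + 1) + sum (λ v → ι (δ u v) * (deg D v ∸ (a + 1)))
          ≤⟨ sum-mono-+ {f = λ v → ι (C v) * (a + 1)} pointwise ⟩
        ∑ᶜ (deg D) ∎
        where
        pointwise : ∀ v → ι (C v) * (a + 1) + ι (δ u v) * (deg D v ∸ (a + 1)) ≤ ι (C v) * deg D v
        pointwise v with u ≟ v
        ... | yes refl rewrite Cu = ≤-reflexive (trans
              (cong₂ _+_ (*-identityˡ (a + 1)) (*-identityˡ (deg D u ∸ (a + 1))))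
              (trans (m+[n∸m]≡n (min-deg u)) (sym (*-identityˡ (deg D u)))))
        ... | no _ = ≤-trans (≤-reflexive (+-identityʳ _)) (*-monoʳ-≤ (ι (C v)) (min-deg v))

      -- For `r ≡ 1` the bound `total` is at most `4 + 2 * (1 + t)`, which equals `2 * (a + 1)`, the
      -- least possible degree sum of the two vertices of `C`. Both degrees are therefore `a + 1`,
      -- and there is no gap.
      slack : ∀ u → C u ≡ true → (deg D u ∸ (a + 1)) + ∑gap ≤ 0
      slack u Cu = +-cancelˡ-≤ ((r + r) * (a + 1)) _ _ (begin
        (r + r) * (a + 1) + ((deg D u ∸ (a + 1)) + ∑gap) ≡⟨ sym (+-assoc ((r + r) * (a + 1)) _ ∑gap) ⟩
        (r + r) * (a + 1) + (deg D u ∸ (a + 1)) + ∑gap   ≤⟨ +-monoˡ-≤ ∑gap (∑deg-lower u Cu) ⟩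
        ∑ᶜ (deg D) + ∑gap                                ≤⟨ total ⟩
        2 * E + (r + r) * R                              ≤⟨ +-monoˡ-≤ _ (*-monoʳ-≤ 2 E≤2) ⟩
        4 + (r + r) * R                                  ≡⟨ cong (λ z → 4 + (z + z) * (z + t)) r≡1 ⟩
        4 + 2 * (1 + t)                                  ≡⟨ lem t ⟩
        2 * (2 + t + 1) + 0                              ≡⟨ cong₂ (λ z y → (z + z) * (y + 1) + 0) (sym r≡1) (sym a≡2+t) ⟩
        (r + r) * (a + 1) + 0                            ∎)
        where
        lem : ∀ t → 4 + 2 * (1 + t) ≡ 2 * (2 + t + 1) + 0
        lem = solve-∀

      inside : ∀ b → ∃ λ u → C u ≡ true × c u ≡ b
      inside b = let u , bu = #≥1⇒∃ {p = Cᵇ b} (≤-trans 1≤r (≤-reflexive (sym (size b)))) ; Cu , su = ∧-true {C u} bu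
                 in u , Cu , side⇒ su

      adjacent : ∀ {u v} → C u ≡ true → C v ≡ false → c u ≡ c v → Arc D u (π v) ⊎ Arc D v (π u)
      adjacent {u} {v} Cu Cv cuv with arc D u (π v) in uv | arc D v (π u) in vu
      ... | true  | _     = inj₁ refl
      ... | false | true  = inj₂ refl
      ... | false | false = ⊥-elim (1+n≰n (begin
            1                 ≤⟨ ∃⇒#≥1 {p = gap u} v gap-uv ⟩
            # (gap u)         ≡⟨ sym (*-identityˡ (# (gap u))) ⟩
            1 * # (gap u)     ≡⟨ cong (λ b → ι b * # (gap u)) (sym Cu) ⟩
            ι (C u) * # (gap u) ≤⟨ term≤sum (λ u → ι (C u) * # (gap u)) u ⟩
            ∑gap              ≤⟨ m≤n+m ∑gap (deg D u ∸ (a + 1)) ⟩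
            _                 ≤⟨ slack u Cu ⟩
            0                 ∎))
        where
        gap-uv : gap u v ≡ true
        gap-uv = true-∧ (cong not Cv) (true-∧ (⇒side (sym cuv)) (true-∧ (cong not uv) (cong not vu)))

      -- A vertex `u` of `C` on the side of `v` has degree at most `a + 1` and, since no gap occurs,
      -- forms a dominating pair with `v`. This leaves at least `2a` for `v`.
      outside-full : ∀ v → C v ≡ false → 2 * a ≤ deg D v
      outside-full v Cv with u , Cu , cu ← inside (c v) = +-cancelˡ-≤ (a + 1) _ _ (begin
        a + 1 + 2 * a           ≡⟨ lem a ⟩
        3 * a + 1               ≤⟨ heavy u v dominating ⟩
        deg D u + deg D v       ≤⟨ +-monoˡ-≤ (deg D v) (m∸n≡0⇒m≤n {deg D u} {a + 1} (n≤0⇒n≡0 (≤-trans (m≤m+n _ ∑gap) (slack u Cu)))) ⟩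
        a + 1 + deg D v         ∎)
        where
        lem : ∀ a → a + 1 + 2 * a ≡ 3 * a + 1
        lem = solve-∀
        u≢v : u ≢ v
        u≢v refl = not-both Cu Cv
        dominating : Dominating D u v
        dominating with adjacent Cu Cv cu
        ... | inj₁ e = u≢v , π v , e , π-arc v
        ... | inj₂ e = u≢v , π u , π-arc u , e

      impossible : ⊥
      impossible =
        let v , e = #≥1⇒∃ {p = λ v → not (C v) ∧ side true v} (≤-trans (≤-trans 1≤r (m≤m+n r t)) (≤-reflexive (sym (co-size true))))
            Cv = not-true (proj₁ (∧-true {not (C v)} e))
            u , Cu , cu = inside (c v)
            -- Both `v` and `π v` lie outside `C` and have full degree, which supplies the two arcs
            -- of a merge.
            uπv = proj₂ (deg-full (outside-full (π v) (trans (closed v) Cv)) (trans cu (arc-side′ (π-arc v))))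
            vπu = proj₁ (deg-full (outside-full v Cv) (trans (arc-side (π-arc u)) (cong not cu)))
        in unmergeable Cu Cv uπv vπu

    impossible : ⊥
    impossible with 2 ≤? r
    ... | yes 2≤r = r≥2-impossible 2≤r
    ... | no 2≰r  = Digon.impossible (≤-antisym (≤-pred (≰⇒> 2≰r)) 1≤r)

-- Strong connectivity

module Strong {n} (D : Digraph n) (a : ℕ) (c : Fin n → Bool)
  (bip : ∀ u v → Arc D u v → c u ≢ c v)
  (heavy : ∀ u v → Dominating D u v → 3 * a + 1 ≤ deg D u + deg D v)
  (side-size : ∀ b → # (Bipartite.side D a c bip heavy b) ≡ a)
  (2≤a : 2 ≤ a) (strong : StronglyConnected D) where

  open Bipartite D a c bip heavy
  open Balanced D a c bip heavy side-size
  open ≤-Reasoning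

  private
    V : Set
    V = Fin n

  opposite : ∀ v → ∃ λ w → c w ≡ not (c v)
  opposite v = let w , e = #≥1⇒∃ {p = side (not (c v))} (≤-trans (<⇒≤ 2≤a) (≤-reflexive (sym (side-size _)))) in w , side⇒ e

  opposite-≢ : ∀ {v w} → c w ≡ not (c v) → v ≢ w
  opposite-≢ {v} e refl = not-¬ {c v} refl e

  out-neighbour : ∀ v → ∃ λ w → Arc D v w
  out-neighbour v = let w , e = opposite v in first (strong v w) (opposite-≢ e)
    where
    first : ∀ {v w} → Walk D v w → v ≢ w → ∃ λ w → Arc D v w
    first here       ne = ⊥-elim (ne refl)
    first (step e _) _  = _ , e

  in-neighbour : ∀ v → ∃ λ w → Arc D w v
  in-neighbour v = let w , e = opposite v in last (strong w v) (opposite-≢ e ∘ sym)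
    where
    last : ∀ {w v} → Walk D w v → w ≢ v → ∃ λ u → Arc D u v
    last here ne = ⊥-elim (ne refl)
    last {w} {v} (step {w = z} e rest) ne with z ≟ v
    ... | yes refl = w , e
    ... | no z≢v   = last rest z≢v

  deg≤2a : ∀ v → deg D v ≤ 2 * a
  deg≤2a v = begin
    deg D v                                  ≡⟨ deg≡sum v ⟩
    # (arc D v) + # (λ w → arc D w v)        ≤⟨ +-mono-≤ (out≤ v) (in≤ v) ⟩
    a + a                                    ≡⟨ sym (cong (a +_) (+-identityʳ a)) ⟩
    2 * a                                    ∎

  Lonely : V → Set
  Lonely v = ∀ u → ¬ Dominating D v u

  -- If v → w with v lonely, then v is the only in-neighbour of w, so d(w) ≤ a + 1 and a partner of w
  -- would have degree 2a; all of v's side would dominate that partner.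
  lonely-arc : ∀ {v w} → Lonely v → Arc D v w → Lonely w
  lonely-arc {v} {w} lonely vw w′ (w≢w′ , z , wz , w′z) =
    let u , v≢u , su = #≥2⇒∃≢ {p = side (c v)} v (≤-trans 2≤a (≤-reflexive (sym (side-size _))))
        same : c w ≡ c w′
        same = trans (arc-side′ wz) (sym (arc-side′ w′z))
        v-opp : c v ≡ not (c w′)
        v-opp = trans (arc-side′ vw) (cong not same)
    in lonely u (v≢u , w′ , proj₂ (deg-full full v-opp) , proj₂ (deg-full full (trans (side⇒ su) v-opp)))
    where
    only-v : ∀ u → Arc D u w → v ≡ u
    only-v u uw with v ≟ u
    ... | yes e = e
    ... | no ne = ⊥-elim (lonely u (ne , w , vw , uw))
    deg-w : deg D w ≤ a + 1
    deg-w = ≤-trans (≤-reflexive (deg≡sum w)) (+-mono-≤ (out≤ w)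
      (#-unique {p = λ u → arc D u w} λ u u′ e e′ → trans (sym (only-v u e)) (only-v u′ e′)))
    full : 2 * a ≤ deg D w′
    full = +-cancelˡ-≤ (a + 1) _ _ (begin
      a + 1 + 2 * a         ≡⟨ lem a ⟩
      3 * a + 1             ≤⟨ heavy w w′ (w≢w′ , z , wz , w′z) ⟩
      deg D w + deg D w′    ≤⟨ +-monoˡ-≤ (deg D w′) deg-w ⟩
      a + 1 + deg D w′      ∎)
      where
      lem : ∀ a → a + 1 + 2 * a ≡ 3 * a + 1
      lem = solve-∀

  lonely-walk : ∀ {u v} → Walk D u v → Lonely u → Lonely v
  lonely-walk here       l = l
  lonely-walk (step e p) l = lonely-walk p (lonely-arc l e)

  partner? : ∀ v → Dec (∃ λ u → Dominating D v u)
  partner? v = any? λ u → ¬? (v ≟ u) ×-dec any? λ w → (arc D v w Bool.≟ true) ×-dec (arc D u w Bool.≟ true)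

  -- The partner contributes at most `2a` to a sum of at least `3a + 1`.
  partner⇒min-deg : ∀ v → (∃ λ u → Dominating D v u) → a + 1 ≤ deg D v
  partner⇒min-deg v (u , vu) = +-cancelʳ-≤ (2 * a) _ _ (begin
    a + 1 + 2 * a         ≡⟨ lem a ⟩
    3 * a + 1             ≤⟨ heavy v u vu ⟩
    deg D v + deg D u     ≤⟨ +-monoʳ-≤ (deg D v) (deg≤2a u) ⟩
    deg D v + 2 * a       ∎)
    where
    lem : ∀ a → a + 1 + 2 * a ≡ 3 * a + 1
    lem = solve-∀

  -- Without dominating pairs every vertex has at most one in-neighbour, so any choice of
  -- out-neighbours is injective and contains every arc.
  module AllLonely (lonely : ∀ v → Lonely v) where

    unique-in : ∀ {u v w} → Arc D u w → Arc D v w → u ≡ v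
    unique-in {u} {v} {w} uw vw with u ≟ v
    ... | yes e = e
    ... | no ne = ⊥-elim (lonely u v (ne , w , uw , vw))

    F : CycleFactor D
    F = record
      { π = λ v → proj₁ (out-neighbour v)
      ; π-inj = λ {u} {v} e → unique-in (proj₂ (out-neighbour u)) (subst (Arc D v) (sym e) (proj₂ (out-neighbour v)))
      ; π-arc = λ v → proj₂ (out-neighbour v) }

    hamiltonian : V → Hamiltonian D
    hamiltonian v₀ = orbit-full⇒hamiltonian D F v₀ λ w → walk-closed (strong v₀ w) (Reach⇒orbit (0 , refl))
      where
      open CycleFactor F
      open Orbit π π-inj v₀
      walk-closed : ∀ {u v} → Walk D u v → orbit u ≡ true → orbit v ≡ true
      walk-closed here u∈ = u∈
      -- The head `w` is `π v` for some `v`, and its only in-neighbour is `u`; the walk thus follows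
      -- `π`.
      walk-closed (step {u} {w} uw p) u∈ with v , refl ← injective⇒surjective π-inj w =
        walk-closed p (trans (orbit-closed v) (trans (cong orbit (unique-in (π-arc v) uw)) u∈))

  -- Cycle factor and successive merging when every degree is at least `a + 1`.

  module Companions (min-deg : ∀ v → a + 1 ≤ deg D v) where

    module NotDeficient (H : Hall.Deficient D) where

      open Hall.Deficient H

      b : Bool
      b = c root

      -- Restricting `S` to the side of `root` preserves the deficiency, because all in-neighbours
      -- of a vertex lie on one side.
      T : V → Bool
      T v = S v ∧ side b v

      T⇒ : ∀ {v} → T v ≡ true → S v ≡ true × c v ≡ b
      T⇒ {v} e = let s , q = ∧-true {S v} e in s , side⇒ q

      N? : ∀ y → Dec (∃ λ s → T s ≡ true × Arc D s y)
      N? y = any? λ s → (T s Bool.≟ true) ×-dec (arc D s y Bool.≟ true)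

      N : V → Bool
      N y = does (N? y)

      ⇒N : ∀ {s y} → T s ≡ true → Arc D s y → N y ≡ true
      ⇒N {s} {y} t e = dec-true (N? y) (s , t , e)

      T-root : V → Bool
      T-root v = not (δ root v) ∧ T v

      N<T : # N + 1 ≤ # T
      N<T = ≤-trans (+-monoˡ-≤ 1 (#-surjection {p = T-root} f onto))
        (#-insert {p = T-root} root (λ v e → proj₂ (∧-true {not (δ root v)} e))
          (cong (λ z → not z ∧ T root) (dec-true (root ≟ root) refl))
          (true-∧ root∈S (⇒side refl)))
        where
        onto : ∀ y → N y ≡ true → ∃ λ t → T-root t ≡ true × f t ≡ y
        onto y e =
          let s , t∈ , sy = does⇒ (N? y) e
              t , t≢ , ft , ty , t∈S = covered (proj₁ (T⇒ t∈)) sy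
          in t , true-∧ (cong not (dec-false (root ≟ t) (t≢ ∘ sym)))
                   (true-∧ t∈S (⇒side (trans (arc-side′ ty) (trans (sym (arc-side′ sy)) (proj₂ (T⇒ t∈)))))) , ft

      deg-T : ∀ {s} → T s ≡ true → deg D s ≤ # N + a
      deg-T {s} t = ≤-trans (≤-reflexive (deg≡sum s)) (+-mono-≤ (#-mono {p = arc D s} {q = N} λ y sy → ⇒N t sy) (in≤ s))

      -- Since `N` is smaller than `T`, two vertices of `T` choose the same out-neighbour and
      -- dominate. Each has degree at most `# N + a`.
      a<2N : a + 1 ≤ # N + # N
      a<2N with s₁ , s₂ , ne , t₁ , t₂ , e ← #-pigeonhole {p = T} {q = N} (proj₁ ∘ out-neighbour)
                  (λ v t → ⇒N t (proj₂ (out-neighbour v))) (≤-trans (≤-reflexive (+-comm 1 (# N))) N<T) =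
        +-cancelˡ-≤ (a + a) _ _ (begin
          a + a + (a + 1)         ≡⟨ lem a ⟩
          3 * a + 1               ≤⟨ heavy s₁ s₂ (ne , _ , proj₂ (out-neighbour s₁) , subst (Arc D s₂) (sym e) (proj₂ (out-neighbour s₂))) ⟩
          deg D s₁ + deg D s₂     ≤⟨ +-mono-≤ (deg-T t₁) (deg-T t₂) ⟩
          # N + a + (# N + a)     ≡⟨ lem′ (# N) a ⟩
          a + a + (# N + # N)     ∎)
        where
        lem : ∀ a → a + a + (a + 1) ≡ 3 * a + 1
        lem = solve-∀
        lem′ : ∀ N a → N + a + (N + a) ≡ a + a + (N + N)
        lem′ = solve-∀

      U : V → Bool
      U y = not (N y) ∧ side (not b) y

      U⇒ : ∀ {y} → U y ≡ true → N y ≡ false × c y ≡ not b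
      U⇒ {y} e = let n , s = ∧-true {not (N y)} e in not-true n , side⇒ s

      a≤N+U : a ≤ # N + # U
      a≤N+U = begin
        a                                             ≡⟨ sym (side-size (not b)) ⟩
        # (side (not b))                              ≡⟨ #-split (side (not b)) N ⟩
        # (λ y → N y ∧ side (not b) y) + # U          ≤⟨ +-monoˡ-≤ (# U) (#-mono {p = λ y → N y ∧ side (not b) y} {q = N} λ y e → proj₁ (∧-true e)) ⟩
        # N + # U                                     ∎

      -- The in-neighbours of `y` and the set `T` are disjoint parts of one side.
      in-U : ∀ {y} → U y ≡ true → # (λ w → arc D w y) + # T ≤ a
      in-U {y} u = ≮⇒≥ λ lt →
        let v , vy , t = #-overlap {p = λ w → arc D w y} {q = T} {s = side b}
                (λ v vy → ⇒side (trans (arc-side′ vy) (trans (cong not (proj₂ (U⇒ u))) (not-involutive b))))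
                (λ v t → ⇒side (proj₂ (T⇒ t))) (≤-trans (≤-reflexive (cong suc (side-size b))) lt)
        in not-both (⇒N t vy) (proj₁ (U⇒ u))

      -- Some in-neighbour of `y` takes up room outside `T`. This strict bound is what provides a
      -- second vertex of `U`.
      T<a : ∀ {y} → U y ≡ true → 1 + # T ≤ a
      T<a {y} u = ≤-trans (+-monoˡ-≤ (# T) (∃⇒#≥1 {p = λ w → arc D w y} (proj₁ (in-neighbour y)) (proj₂ (in-neighbour y)))) (in-U u)

      T≤a : # T ≤ a
      T≤a = ≤-trans (#-mono {p = T} {q = side b} λ v t → ⇒side (proj₂ (T⇒ t))) (≤-reflexive (side-size b))

      U≥ : ∀ k → k + # T ≤ a → 1 + k ≤ # U
      U≥ k h = +-cancelˡ-≤ (# N) _ _ (begin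
        # N + (1 + k)      ≡⟨ trans (sym (+-assoc (# N) 1 k)) (+-comm (# N + 1) k) ⟩
        k + (# N + 1)      ≤⟨ +-monoʳ-≤ k N<T ⟩
        k + # T            ≤⟨ h ⟩
        a                  ≤⟨ a≤N+U ⟩
        # N + # U          ∎)

      -- The total degree is at least `a + 1`, while at most `a - # T` of it comes from in-arcs.
      out-U : ∀ {y} → U y ≡ true → 1 + # T ≤ # (arc D y)
      out-U {y} u = +-cancelˡ-≤ a _ _ (begin
        a + (1 + # T)                                  ≡⟨ sym (+-assoc a 1 (# T)) ⟩
        a + 1 + # T                                    ≤⟨ +-monoˡ-≤ (# T) (≤-trans (min-deg y) (≤-reflexive (deg≡sum y))) ⟩
        # (arc D y) + # (λ w → arc D w y) + # T        ≡⟨ +-assoc (# (arc D y)) _ (# T) ⟩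
        # (arc D y) + (# (λ w → arc D w y) + # T)      ≤⟨ +-monoʳ-≤ (# (arc D y)) (in-U u) ⟩
        # (arc D y) + a                                ≡⟨ +-comm (# (arc D y)) a ⟩
        a + # (arc D y)                                ∎)

      deg-U : ∀ {y} → U y ≡ true → deg D y + # T ≤ a + a
      deg-U {y} u = begin
        deg D y + # T                                  ≡⟨ cong (_+ # T) (deg≡sum y) ⟩
        # (arc D y) + # (λ w → arc D w y) + # T        ≡⟨ +-assoc (# (arc D y)) _ (# T) ⟩
        # (arc D y) + (# (λ w → arc D w y) + # T)      ≤⟨ +-mono-≤ (out≤ y) (in-U u) ⟩
        a + a                                          ∎

      2T>a : a + 3 ≤ # T + # T
      2T>a = begin
        a + 3                  ≡⟨ sym (+-assoc a 1 2) ⟩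
        a + 1 + 2              ≤⟨ +-monoˡ-≤ 2 a<2N ⟩
        # N + # N + 2          ≡⟨ lem (# N) ⟩
        # N + 1 + (# N + 1)    ≤⟨ +-mono-≤ N<T N<T ⟩
        # T + # T              ∎
        where
        lem : ∀ N → N + N + 2 ≡ N + 1 + (N + 1)
        lem = solve-∀

      impossible : ⊥
      impossible =
        let y₁ , u₁ = #≥1⇒∃ {p = U} (U≥ 0 T≤a)
            y₂ , ne , u₂ = #≥2⇒∃≢ {p = U} y₁ (U≥ 1 (T<a u₁))
            out-side : ∀ {y} → U y ≡ true → ∀ v → arc D y v ≡ true → side b v ≡ true
            out-side u v yv = ⇒side (trans (arc-side yv) (trans (cong not (proj₂ (U⇒ u))) (not-involutive b)))
            -- Each out-neighbourhood has more than `a / 2` vertices of the same side, so the two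
            -- meet.
            w , y₁w , y₂w = #-overlap {p = arc D y₁} {q = arc D y₂} {s = side b} (out-side u₁) (out-side u₂) (begin
              1 + # (side b)               ≡⟨ cong suc (side-size b) ⟩
              1 + a                        ≡⟨ +-comm 1 a ⟩
              a + 1                        ≤⟨ +-monoʳ-≤ a (s≤s z≤n) ⟩
              a + 3                        ≤⟨ 2T>a ⟩
              # T + # T                    ≤⟨ +-mono-≤ (n≤1+n _) (n≤1+n _) ⟩
              1 + # T + (1 + # T)          ≤⟨ +-mono-≤ (out-U u₁) (out-U u₂) ⟩
              # (arc D y₁) + # (arc D y₂)  ∎)
        -- The pair has degree sum at most `4a - 2 * # T`, hence at most `3a - 3`, against `3a + 1`.
        in <-irrefl refl (begin-strict
             a + a + (a + a)                          <⟨ m<m+n (a + a + (a + a)) (s≤s z≤n) ⟩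
             a + a + (a + a) + 4                      ≡⟨ lem a ⟩
             3 * a + 1 + (a + 3)                      ≤⟨ +-mono-≤ (heavy y₁ y₂ (ne , w , y₁w , y₂w)) 2T>a ⟩
             deg D y₁ + deg D y₂ + (# T + # T)        ≡⟨ interchange (deg D y₁) (deg D y₂) (# T) ⟩
             deg D y₁ + # T + (deg D y₂ + # T)        ≤⟨ +-mono-≤ (deg-U u₁) (deg-U u₂) ⟩
             a + a + (a + a)                          ∎)
        where
        lem : ∀ a → a + a + (a + a) + 4 ≡ 3 * a + 1 + (a + 3)
        lem = solve-∀
        interchange : ∀ x y t → x + y + (t + t) ≡ x + t + (y + t)
        interchange = solve-∀

    cycle-factor : CycleFactor D
    cycle-factor with Hall.cycle-factor-or-deficient D
    ... | inj₁ F = F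
    ... | inj₂ H = ⊥-elim (NotDeficient.impossible H)

    module _ (F : CycleFactor D) where

      open CycleFactor F

      -- On a closed set `π` injects each side into the other.
      closed-balanced : ∀ (C : V → Bool) → (∀ v → C (π v) ≡ C v) → ∀ b →
        # (λ v → C v ∧ side b v) ≡ # (λ v → C v ∧ side true v)
      closed-balanced C closed true  = refl
      closed-balanced C closed false = ≤-antisym (shift false) (shift true)
        where
        shift : ∀ b → # (λ v → C v ∧ side b v) ≤ # (λ v → C v ∧ side (not b) v)
        shift b = #-injection π (λ v e → let Cv , s = ∧-true {C v} e
                    in true-∧ (trans (closed v) Cv) (⇒side (trans (arc-side (π-arc v)) (cong not (side⇒ s)))))
                    (λ u v _ _ → π-inj)

      unmergeable-half : ∀ (C : V → Bool) → (∀ v → C (π v) ≡ C v) →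
        (∀ {u v} → C u ≡ true → C v ≡ false → Arc D u (π v) → Arc D v (π u) → ⊥) →
        ∀ {v} → C v ≡ true →
        # (λ v → C v ∧ side true v) ≤ # (λ v → not (C v) ∧ side true v) → ⊥
      unmergeable-half C closed unmergeable {v} Cv r≤R =
        NoMerge.impossible min-deg π π-inj π-arc C closed unmergeable r (R ∸ r)
          (trans (sym (side-size true)) (trans (#-split (side true) C) (cong (r +_) (sym (m+[n∸m]≡n r≤R)))))
          (≤-trans (∃⇒#≥1 {p = λ w → C w ∧ side (c v) w} v (true-∧ Cv (⇒side refl)))
            (≤-reflexive (closed-balanced C closed (c v))))
          (closed-balanced C closed)
        where
        r R : ℕ
        r = # (λ v → C v ∧ side true v)
        R = # (λ v → not (C v) ∧ side true v)

      -- Either `C` or its complement holds at most half of each side. The complement is closed too,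
      -- and the merge condition is symmetric under exchanging `u` and `v`.
      mergeable : ∀ (C : V → Bool) → (∀ v → C (π v) ≡ C v) → ∀ {x y} → C x ≡ true → C y ≡ false →
        ∃₂ λ u v → C u ≡ true × C v ≡ false × Arc D u (π v) × Arc D v (π u)
      mergeable C closed Cx Cy
        with any? (λ u → any? λ v → (C u Bool.≟ true) ×-dec (C v Bool.≟ false) ×-dec
                     (arc D u (π v) Bool.≟ true) ×-dec (arc D v (π u) Bool.≟ true))
      ... | yes r = r
      ... | no none with ≤-total (# (λ v → C v ∧ side true v)) (# (λ v → not (C v) ∧ side true v))
      ...   | inj₁ le = ⊥-elim (unmergeable-half C closed (λ Cu Cv uv vu → none (_ , _ , Cu , Cv , uv , vu)) Cx le)
      ...   | inj₂ le = ⊥-elim (unmergeable-half (not ∘ C) (cong not ∘ closed)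
                (λ Cu Cv uv vu → none (_ , _ , not-false Cv , not-true Cu , vu , uv)) (cong not Cy)
                (≤-trans le (≤-reflexive (sum-cong-≗ λ v → cong (λ z → ι (z ∧ side true v)) (sym (not-involutive (C v)))))))
        where
        not-false : ∀ {x} → not x ≡ false → x ≡ true
        not-false {true} _ = refl

    -- Each merge enlarges the orbit of the base point, which moves to `π x`; the fuel `k` bounds
    -- the number of vertices still outside.
    merge-all : ∀ k (F : CycleFactor D) (v₀ : V) →
      n ≤ k + # (Orbit.orbit (CycleFactor.π F) (CycleFactor.π-inj F) v₀) → Hamiltonian D
    merge-all k F v₀ bound with any? (λ w → Orbit.orbit (CycleFactor.π F) (CycleFactor.π-inj F) v₀ w Bool.≟ false)
    ... | no none = orbit-full⇒hamiltonian D F v₀ λ w → ¬-not λ e → none (w , e)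
    merge-all zero F v₀ bound | yes (w , w∉) =
      ⊥-elim (1+n≰n (≤-trans (≤-reflexive (+-comm 1 n)) (≤-trans (+-monoˡ-≤ 1 bound)
        (≤-trans (#-insert {q = λ _ → true} w (λ _ _ → refl) w∉ refl) (#≤n _)))))
    merge-all (suc k) F v₀ bound | yes (w , w∉)
      with x , x′ , x∈ , x′∉ , xx′ , x′x ← mergeable F (Orbit.orbit (CycleFactor.π F) (CycleFactor.π-inj F) v₀)
             (Orbit.orbit-closed (CycleFactor.π F) (CycleFactor.π-inj F) v₀)
             (Orbit.Reach⇒orbit (CycleFactor.π F) (CycleFactor.π-inj F) v₀ (0 , refl)) w∉ =
      merge-all k (Merge.merged D F v₀ x∈ x′∉ xx′ x′x) (CycleFactor.π F x)
        (≤-trans bound (≤-trans (≤-reflexive (trans (sym (+-suc k _)) (cong (k +_) (+-comm 1 _))))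
          (+-monoʳ-≤ k (Merge.merged-larger D F v₀ x∈ x′∉ xx′ x′x))))

  hamiltonian : Hamiltonian D
  hamiltonian with any? (λ v → ¬? (partner? v))
  -- Strong connectivity carries loneliness from one vertex to all.
  ... | yes (v , lone) = AllLonely.hamiltonian (λ w → lonely-walk (strong v w) λ u vu → lone (u , vu)) v
  ... | no none = Companions.merge-all min-deg n (Companions.cycle-factor min-deg) v₀ (m≤m+n n _)
    where
    v₀ : V
    v₀ = proj₁ (#≥1⇒∃ {p = side true} (≤-trans (<⇒≤ 2≤a) (≤-reflexive (sym (side-size true)))))
    min-deg : ∀ v → a + 1 ≤ deg D v
    min-deg v with partner? v
    ... | yes p  = partner⇒min-deg v p
    ... | no lone = ⊥-elim (none (v , lone))

theorem1p6 : (a : ℕ) → a ≥ 2 → (D : Digraph (a + a)) →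
    StronglyConnected D → BalancedBipartite D a →
    (∀ u v → Dominating D u v → deg D u + deg D v ≥ 3 * a + 1) →
    Hamiltonian D
theorem1p6 a 2≤a D strong (c , #true , #false , bip) heavy =
  Strong.hamiltonian D a c bip heavy side-size 2≤a strong
  where
  side-size : ∀ b → # (Bipartite.side D a c bip heavy b) ≡ a
  side-size true  = trans (sum-cong-≗ λ v → cong ι (lem (c v))) (trans (sym (count≡# c)) #true)
    where
    lem : ∀ x → does (x Bool.≟ true) ≡ x
    lem true  = refl
    lem false = refl
  side-size false = trans (sum-cong-≗ λ v → cong ι (lem (c v))) (trans (sym (count≡# (λ v → if c v then false else true))) #false)
    where
    lem : ∀ x → does (x Bool.≟ false) ≡ (if x then false else true)
    lem true  = refl
    lem false = refl
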